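{- The Shortest Path under the Deterministic Correlated Model (SPDCM) problem is NP-hard. That is, the following optimization problem is NP-hard: given a directed network $G(\mathcal{N},\mathcal{L})$ whose link costs $w(l)$, $l\in\mathcal{L}$, follow the deterministic correlated model, a source $s\in\mathcal{N}$ and a destination $t\in\mathcal{N}$, find a path from $s$ to $t$ of minimum cost, where the cost of a path is the joint total cost of its links.
   Context: A network $G(\mathcal{N},\mathcal{L})$ has a set $\mathcal{N}$ of $N$ nodes and a set $\mathcal{L}$ of $L$ links. Paths are simple (no looping). Deterministic correlated model: each link $l$ has a nonnegative cost $w(l)$. For any $m>1$ distinct links $l_1,\dots,l_m$ the joint total cost is $$w(l_1)\oplus w(l_2)\oplus\cdots\oplus w(l_m)=\rho_{1,2,\dots,m}\cdot\big(w(l_1)+w(l_2)+\cdots+w(l_m)\big),$$ where $\rho_{1,\dots,m}\in(0,\infty)$ is the correlation coefficient of this set of links ($\rho=1$: uncorrelated, $\rho>1$: increasing correlation, $\rho<1$: decreasing correlation). The joint total cost of a single link $l$ is $w(l)$. The cost of a path is the joint total cost of the set of all its links. The costs and the correlations are part of the problem instance, given by a description from which the joint total cost of any given set of links can be computed in polynomial time. -}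

module Defs where

open import Data.Bool using (Bool; true; false; if_then_else_)
open import Data.Empty using (⊥)
open import Data.Fin using (Fin; zero; toℕ)
open import Data.Fin.Subset using (Subset; ⁅_⁆; ⋃; ∣_∣; Nonempty)
open import Data.Fin.Subset.Properties using (_∈?_)
open import Data.Integer as ℤ using ()
open import Data.List using (List; []; _∷_; length; lookup; map; foldr; filter; allFin)
open import Data.List.Relation.Unary.Unique.Propositional using (Unique)
open import Data.Nat using (ℕ; zero; suc; _+_; _*_; _≤_; _<_; _<?_)
open import Data.Nat.Binary as ℕᵇ using (ℕᵇ; 2[1+_]; 1+[2_])
open import Data.Product using (Σ-syntax; ∃-syntax; _×_; _,_; proj₁; proj₂)
open import Data.Rational as ℚ using (ℚ; 0ℚ; ↥_; ↧ₙ_)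
open import Data.Unit using (⊤; tt)
open import Data.Vec as Vec using (Vec; _[_]≔_)
open import Function.Bundles using (_⇔_)
open import Relation.Binary.PropositionalEquality using (_≡_)
open import Relation.Nullary.Decidable using (⌊_⌋)

------------------------------------------------------------------------
-- Model of computation: N. D. Jones's WHILE language over binary trees.

infixr 5 _∙_

data Tree : Set where
  nil : Tree
  _∙_ : Tree → Tree → Tree

size : Tree → ℕ
size nil     = 1
size (a ∙ b) = suc (size a + size b)

left right : Tree → Tree
left nil      = nil
left (a ∙ b)  = a
right nil     = nil
right (a ∙ b) = b

Store : ℕ → Set
Store k = Vec Tree k

data Expr (k : ℕ) : Set where
  var  : Fin k → Expr k
  nil  : Expr k
  cons : Expr k → Expr k → Expr k
  hd   : Expr k → Expr k
  tl   : Expr k → Expr k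

eval : ∀ {k} → Expr k → Store k → Tree
eval (var x)    σ = Vec.lookup σ x
eval nil        σ = nil
eval (cons e f) σ = eval e σ ∙ eval f σ
eval (hd e)     σ = left (eval e σ)
eval (tl e)     σ = right (eval e σ)

-- Reading a variable is charged the full size of its contents.  With unit
-- costs, repeating X := cons X X would build trees of exponential size in
-- polynomial time; here time bounds every tree built, so polynomial time
-- agrees with polynomial time on Turing machines, also for functions.
time : ∀ {k} → Expr k → Store k → ℕ
time (var x)    σ = size (Vec.lookup σ x)
time nil        σ = 1
time (cons e f) σ = suc (time e σ + time f σ)
time (hd e)     σ = suc (time e σ)
time (tl e)     σ = suc (time e σ)

infix  4 _≔_
infixr 3 _⨾_

-- Q is the set of oracles that may be called; Q = ⊥ gives ordinary programs.
data Cmd (Q : Set) (k : ℕ) : Set where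
  _≔_   : Fin k → Expr k → Cmd Q k
  ask   : Q → Fin k → Expr k → Cmd Q k
  _⨾_   : Cmd Q k → Cmd Q k → Cmd Q k
  ifte  : Expr k → Cmd Q k → Cmd Q k → Cmd Q k
  while : Expr k → Cmd Q k → Cmd Q k

Oracles : Set → Set
Oracles Q = Q → Tree → Tree

-- Run O c σ n τ: command c started in σ stops in τ after time n.
-- In tests nil is false and every other tree is true.
data Run {Q : Set} (O : Oracles Q) {k : ℕ} : Cmd Q k → Store k → ℕ → Store k → Set where
  assign : ∀ {x e σ} →
    Run O (x ≔ e) σ (suc (time e σ)) (σ [ x ]≔ eval e σ)
  asks : ∀ {q x e σ} →
    Run O (ask q x e) σ (suc (time e σ + size (O q (eval e σ)))) (σ [ x ]≔ O q (eval e σ))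
  seq : ∀ {c d σ τ υ m n} →
    Run O c σ m τ → Run O d τ n υ → Run O (c ⨾ d) σ (m + n) υ
  if-true : ∀ {e c d σ τ n a b} → eval e σ ≡ a ∙ b →
    Run O c σ n τ → Run O (ifte e c d) σ (suc (time e σ + n)) τ
  if-false : ∀ {e c d σ τ n} → eval e σ ≡ nil →
    Run O d σ n τ → Run O (ifte e c d) σ (suc (time e σ + n)) τ
  while-true : ∀ {e c σ τ υ m n a b} → eval e σ ≡ a ∙ b →
    Run O c σ m τ → Run O (while e c) τ n υ →
    Run O (while e c) σ (suc (time e σ + (m + n))) υ
  while-false : ∀ {e c σ} → eval e σ ≡ nil →
    Run O (while e c) σ (suc (time e σ)) σ

-- Variable zero holds the input and the output; the other `vars` variables
-- are initially nil.
record Program (Q : Set) : Set where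
  constructor program
  field
    vars : ℕ
    body : Cmd Q (suc vars)

initial : ∀ {k} → Tree → Store (suc k)
initial x = x Vec.∷ Vec.replicate _ nil

Outputs : ∀ {Q} → Oracles Q → Program Q → Tree → Tree → ℕ → Set
Outputs O P x y T =
  ∃[ n ] ∃[ τ ] n ≤ T × Run O (Program.body P) (initial x) n τ × Vec.head τ ≡ y

noOracle : Oracles ⊥
noOracle ()

------------------------------------------------------------------------
-- Encodings as trees

codeBool : Bool → Tree
codeBool false = nil
codeBool true  = nil ∙ nil

codeList : ∀ {A : Set} → (A → Tree) → List A → Tree
codeList f []       = nil
codeList f (x ∷ xs) = f x ∙ codeList f xs

codeBits : List Bool → Tree
codeBits = codeList codeBool

unary : ℕ → Tree
unary zero    = nil
unary (suc n) = nil ∙ unary n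

codeFin : ∀ {n} → Fin n → Tree
codeFin i = unary (toℕ i)

binary : ℕ → Tree
binary n = digits (ℕᵇ.fromℕ n)
  where
  digits : ℕᵇ → Tree
  digits ℕᵇ.zero  = nil
  digits 2[1+ b ] = codeBool false ∙ digits b
  digits 1+[2 b ] = codeBool true ∙ digits b

-- Drops the sign: used for nonnegative rationals only.
codeℚ : ℚ → Tree
codeℚ q = binary ℤ.∣ ↥ q ∣ ∙ binary (↧ₙ q)

codeSubset : ∀ {n} → Subset n → Tree
codeSubset S = codeBits (Vec.toList S)

codeExpr : ∀ {k} → Expr k → Tree
codeExpr (var x)    = unary 0 ∙ codeFin x
codeExpr nil        = unary 1 ∙ nil
codeExpr (cons e f) = unary 2 ∙ codeExpr e ∙ codeExpr f
codeExpr (hd e)     = unary 3 ∙ codeExpr e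
codeExpr (tl e)     = unary 4 ∙ codeExpr e

codeCmd : ∀ {k} → Cmd ⊥ k → Tree
codeCmd (x ≔ e)      = unary 0 ∙ codeFin x ∙ codeExpr e
codeCmd (ask () x e)
codeCmd (c ⨾ d)      = unary 1 ∙ codeCmd c ∙ codeCmd d
codeCmd (ifte e c d) = unary 2 ∙ codeExpr e ∙ codeCmd c ∙ codeCmd d
codeCmd (while e c)  = unary 3 ∙ codeExpr e ∙ codeCmd c

codeProgram : Program ⊥ → Tree
codeProgram (program k c) = unary k ∙ codeCmd c

------------------------------------------------------------------------
-- NP and NP-hardness

-- Coefficient lists, constant term first.
Polynomial : Set
Polynomial = List ℕ

⟦_⟧ : Polynomial → ℕ → ℕ
⟦ [] ⟧    n = 0
⟦ a ∷ p ⟧ n = a + n * ⟦ p ⟧ n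

Language : Set₁
Language = List Bool → Set

record NP (L : Language) : Set where
  field
    verifier      : Program ⊥
    runtime       : Polynomial
    witnessLength : Polynomial
    verdict       : List Bool → List Bool → Bool
    verifies      : ∀ x u →
      Outputs noOracle verifier (codeBits x ∙ codeBits u) (codeBool (verdict x u))
              (⟦ runtime ⟧ (length x + length u))
    correct       : ∀ x →
      L x ⇔ (∃[ u ] length u ≤ ⟦ witnessLength ⟧ (length x) × verdict x u ≡ true)

-- Answer I y: the tree y encodes a solution of the instance I.
record SearchProblem : Set₁ where
  field
    Instance : Set
    code     : Instance → Tree
    Answer   : Instance → Tree → Set

-- Nothing is assumed about O on unsolvable instances or on trees that do not
-- encode an instance.
Solves : (Tree → Tree) → SearchProblem → Set
Solves O Π = ∀ I → (∃[ y ] Answer I y) → Answer I (O (code I))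
  where open SearchProblem Π

-- Polynomial-time Turing reduction of a language to a search problem.
record _≤ᵀ_ (L : Language) (Π : SearchProblem) : Set where
  field
    reduction : Program ⊤
    runtime   : Polynomial
    decides   : ∀ (O : Tree → Tree) → Solves O Π → ∀ x →
      ∃[ b ] Outputs (λ _ → O) reduction (codeBits x) (codeBool b) (⟦ runtime ⟧ (length x))
             × (L x ⇔ b ≡ true)

NPHard : SearchProblem → Set₁
NPHard Π = ∀ (L : Language) → NP L → L ≤ᵀ Π

------------------------------------------------------------------------
-- Directed networks and simple paths

record Network : Set where
  field
    N        : ℕ
    links    : List (Fin N × Fin N)
    distinct : Unique links

  Node : Set
  Node = Fin N

  L : ℕ
  L = length links

  Link : Set
  Link = Fin L

  tail head : Link → Node
  tail l = proj₁ (lookup links l)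
  head l = proj₂ (lookup links l)

  IsWalk : Node → List Link → Node → Set
  IsWalk u []       v = u ≡ v
  IsWalk u (l ∷ ls) v = tail l ≡ u × IsWalk (head l) ls v

  record Path (s t : Node) : Set where
    field
      route  : List Link
      isWalk : IsWalk s route t
      simple : Unique (s ∷ map head route)

    linkSet : Subset L
    linkSet = ⋃ (map ⁅_⁆ route)

------------------------------------------------------------------------
-- The deterministic correlated model

sumℚ : List ℚ → ℚ
sumℚ = foldr ℚ._+_ 0ℚ

-- ρ is only meaningful on sets of more than one link.
record Correlated (L : ℕ) : Set where
  field
    w   : Fin L → ℚ
    ρ   : Subset L → ℚ
    w≥0 : ∀ l → 0ℚ ℚ.≤ w l
    ρ>0 : ∀ S → 1 < ∣ S ∣ → 0ℚ ℚ.< ρ S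

  total : Subset L → ℚ
  total S = sumℚ (map w (filter (_∈? S) (allFin L)))

  -- A singleton costs w l; the empty set (the trivial path when s ≡ t) costs 0.
  jointCost : Subset L → ℚ
  jointCost S = if ⌊ 1 <? ∣ S ∣ ⌋ then ρ S ℚ.* total S else total S

-- A description from which joint costs can be computed in polynomial time:
-- data, an evaluation program, and a time allowance within which the program
-- computes the joint cost of any given set.  Since the allowance is written in
-- unary, simulating the program takes time polynomial in the size of the
-- description; conversely, any format of descriptions with a polynomial-time
-- evaluator can be presented in this way.
record Description : Set where
  field
    payload   : Tree
    evaluator : Program ⊥
    allowance : ℕ

  Describes : ∀ {L} → Correlated L → Set
  Describes M = ∀ S → Nonempty S →
    Outputs noOracle evaluator (payload ∙ codeSubset S) (codeℚ (jointCost S)) allowance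
    where open Correlated M

  codeDescription : Tree
  codeDescription = payload ∙ codeProgram evaluator ∙ unary allowance

------------------------------------------------------------------------
-- Shortest path under the deterministic correlated model

record SPDCM-Instance : Set where
  field
    network     : Network
  open Network network public
  field
    source      : Node
    destination : Node
    model       : Correlated L
    description : Description
  open Correlated model public
  open Description description public
  field
    describes   : Describes model

  cost : Path source destination → ℚ
  cost p = jointCost (Path.linkSet p)

  Shortest : Path source destination → Set
  Shortest p = ∀ q → cost p ℚ.≤ cost q

  codeLink : Node × Node → Tree
  codeLink (u , v) = codeFin u ∙ codeFin v

  codeInstance : Tree
  codeInstance =
    unary N ∙ codeList codeLink links ∙ codeFin source ∙ codeFin destination ∙ codeDescription

SPDCM : SearchProblem
SPDCM = record
  { Instance = SPDCM-Instance
  ; code     = SPDCM-Instance.codeInstance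
  ; Answer   = λ I y → let open SPDCM-Instance I in
      Σ[ p ∈ Path source destination ] Shortest p × y ≡ codeList codeFin (Path.route p)
  }

{-# OPTIONS --safe #-}
module Submission where

-- No detour through a fixed NP-complete problem is needed, because a
-- description contains a program: the joint cost may be computed by the
-- verifier of the given NP language.  The network has a direct link from s to
-- t of cost 1, and a link from s to a chain of stages in which a path chooses,
-- bit by bit, a witness of bounded length.  The correlations are such that a
-- path through the chain costs 1/2 if the verifier accepts its witness and 2
-- otherwise, so the input is a member iff a shortest path avoids the direct
-- link.  Writing the network in polynomial time is easy; the allowance is
-- obtained by evaluating, in unary, a polynomial that bounds the running time
-- of the evaluator.

open import Data.Bool using (Bool; true; false; if_then_else_)
open import Data.Bool.Properties using (not-¬)
open import Data.Empty using (⊥; ⊥-elim)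
open import Data.Fin using (Fin; zero; suc; toℕ; #_)
open import Data.Fin.Properties using (toℕ<n)
open import Data.Fin.Subset using (Subset; ⁅_⁆; ⋃; _∈_; Nonempty)
open import Data.Fin.Subset.Properties using (_∈?_; ∪-identityˡ; x∈⁅x⁆; x∈p∪q⁺)
open import Data.List as List using (List; []; _∷_; length; map; foldl; reverse; filter)
open import Data.List.Membership.Propositional.Properties using (∈-lookup)
open import Data.List.Properties using (reverse-involutive; length-reverse)
open import Data.List.Relation.Unary.All as All using (All; []; _∷_)
import Data.List.Relation.Unary.All.Properties as Allₚ
open import Data.List.Relation.Unary.AllPairs using ([]; _∷_)
open import Data.List.Relation.Unary.Unique.Propositional using (Unique)
import Data.List.Relation.Unary.Unique.Propositional.Properties as Uniqueₚ
open import Data.Nat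
open import Data.Nat.Properties
open import Data.Nat.Tactic.RingSolver using (solve-∀)
open import Data.Product using (∃-syntax; _×_; _,_; proj₁; proj₂)
open import Data.Rational as ℚ using (ℚ; 0ℚ; 1ℚ; ½)
import Data.Rational.Properties as ℚₚ
open import Data.Sum using (inj₁; inj₂)
open import Data.Unit using (⊤; tt)
open import Data.Vec as Vec using (Vec; []; _∷_; _[_]≔_)
import Data.Vec.Properties as Vecₚ
open import Data.Vec.Relation.Binary.Pointwise.Inductive as Pointwise using (Pointwise; []; _∷_)
open import Function.Bundles using (Equivalence; _⇔_; mk⇔)
open import Relation.Binary.PropositionalEquality
open import Relation.Nullary using (¬_; Dec; yes; no)
open import Relation.Nullary.Decidable using (from-yes; from-no)

open import Defs

-- Polynomial bounds

-- A description must price every nonempty set of links, not only paths. So the correlations are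
-- defined and computed on arbitrary sets: the first three links decide whether the witness matters,
-- and the remaining bits are decoded to some bit string whatever they are. All weight sits on the
-- two links that leave the source. A route uses exactly one of them, so its total is 1 and a
-- coefficient is itself a cost. Coefficients have to be positive, hence 1/2 and 2 on the two sides
-- of 1. A single link has no coefficient, hence the two links at the entrance of the chain: with
-- witness bound 0 there are no stages, and a route avoiding the direct link must still have two
-- links. An oracle is constrained only on solvable instances, so a shortest path has to be
-- exhibited; this is done by a search through all bounded witnesses, in the proof and not in the
-- reduction. An oracle's answer is charged by its size, so path lengths need a bound too; it comes
-- from links that always lower the node number.

infixl 6 _+ᵖ_
infixl 7 _*ᵖ_

_+ᵖ_ : Polynomial → Polynomial → Polynomial
[]      +ᵖ q       = q
(a ∷ p) +ᵖ []      = a ∷ p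
(a ∷ p) +ᵖ (b ∷ q) = a + b ∷ p +ᵖ q

scale : ℕ → Polynomial → Polynomial
scale c = List.map (c *_)

_*ᵖ_ : Polynomial → Polynomial → Polynomial
[]      *ᵖ q = []
(a ∷ p) *ᵖ q = scale a q +ᵖ (0 ∷ p *ᵖ q)

_∘ᵖ_ : Polynomial → Polynomial → Polynomial
[]      ∘ᵖ r = []
(a ∷ p) ∘ᵖ r = (a ∷ []) +ᵖ r *ᵖ (p ∘ᵖ r)

⟦+ᵖ⟧ : ∀ p q n → ⟦ p +ᵖ q ⟧ n ≡ ⟦ p ⟧ n + ⟦ q ⟧ n
⟦+ᵖ⟧ []      q       n = refl
⟦+ᵖ⟧ (a ∷ p) []      n = sym (+-identityʳ _)
⟦+ᵖ⟧ (a ∷ p) (b ∷ q) n rewrite ⟦+ᵖ⟧ p q n = lemma a b n (⟦ p ⟧ n) (⟦ q ⟧ n)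
  where
  lemma : ∀ a b n u v → a + b + n * (u + v) ≡ a + n * u + (b + n * v)
  lemma = solve-∀

⟦scale⟧ : ∀ c p n → ⟦ scale c p ⟧ n ≡ c * ⟦ p ⟧ n
⟦scale⟧ c []      n = sym (*-zeroʳ c)
⟦scale⟧ c (a ∷ p) n rewrite ⟦scale⟧ c p n = lemma c a n (⟦ p ⟧ n)
  where
  lemma : ∀ c a n u → c * a + n * (c * u) ≡ c * (a + n * u)
  lemma = solve-∀

⟦*ᵖ⟧ : ∀ p q n → ⟦ p *ᵖ q ⟧ n ≡ ⟦ p ⟧ n * ⟦ q ⟧ n
⟦*ᵖ⟧ []      q n = refl
⟦*ᵖ⟧ (a ∷ p) q n
  rewrite ⟦+ᵖ⟧ (scale a q) (0 ∷ p *ᵖ q) n | ⟦scale⟧ a q n | ⟦*ᵖ⟧ p q n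
  = lemma a n (⟦ p ⟧ n) (⟦ q ⟧ n)
  where
  lemma : ∀ a n u v → a * v + n * (u * v) ≡ (a + n * u) * v
  lemma = solve-∀

⟦∘ᵖ⟧ : ∀ p r n → ⟦ p ∘ᵖ r ⟧ n ≡ ⟦ p ⟧ (⟦ r ⟧ n)
⟦∘ᵖ⟧ []      r n = refl
⟦∘ᵖ⟧ (a ∷ p) r n
  rewrite ⟦+ᵖ⟧ (a ∷ []) (r *ᵖ (p ∘ᵖ r)) n | ⟦*ᵖ⟧ r (p ∘ᵖ r) n | ⟦∘ᵖ⟧ p r n
  = cong (_+ ⟦ r ⟧ n * ⟦ p ⟧ (⟦ r ⟧ n)) (trans (cong (a +_) (*-zeroʳ n)) (+-identityʳ a))

⟦⟧-mono : ∀ p {m n} → m ≤ n → ⟦ p ⟧ m ≤ ⟦ p ⟧ n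
⟦⟧-mono []      m≤n = z≤n
⟦⟧-mono (a ∷ p) m≤n = +-monoʳ-≤ a (*-mono-≤ m≤n (⟦⟧-mono p m≤n))

-- Polynomials in one variable 𝕟, kept symbolic so that ⟪_⟫ unfolds to plain
-- arithmetic.
infixr 6 _⊕_
infixr 7 _⊗_
infixr 8 _at_

data Bound : Set where
  con     : ℕ → Bound
  𝕟       : Bound
  _⊕_ _⊗_ : Bound → Bound → Bound
  _at_    : Polynomial → Bound → Bound

⟪_⟫ : Bound → ℕ → ℕ
⟪ con c ⟫  n = c
⟪ 𝕟 ⟫      n = n
⟪ a ⊕ b ⟫  n = ⟪ a ⟫ n + ⟪ b ⟫ n
⟪ a ⊗ b ⟫  n = ⟪ a ⟫ n * ⟪ b ⟫ n
⟪ p at b ⟫ n = ⟦ p ⟧ (⟪ b ⟫ n)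

polynomial : Bound → Polynomial
polynomial (con c)  = c ∷ []
polynomial 𝕟        = 0 ∷ 1 ∷ []
polynomial (a ⊕ b)  = polynomial a +ᵖ polynomial b
polynomial (a ⊗ b)  = polynomial a *ᵖ polynomial b
polynomial (p at b) = p ∘ᵖ polynomial b

polynomial-correct : ∀ b n → ⟪ b ⟫ n ≡ ⟦ polynomial b ⟧ n
polynomial-correct (con c)  n = sym (trans (cong (c +_) (*-zeroʳ n)) (+-identityʳ c))
polynomial-correct 𝕟        n = lemma n
  where
  lemma : ∀ n → n ≡ 0 + n * (1 + n * 0)
  lemma = solve-∀
polynomial-correct (a ⊕ b)  n =
  trans (cong₂ _+_ (polynomial-correct a n) (polynomial-correct b n))
        (sym (⟦+ᵖ⟧ (polynomial a) (polynomial b) n))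
polynomial-correct (a ⊗ b)  n =
  trans (cong₂ _*_ (polynomial-correct a n) (polynomial-correct b n))
        (sym (⟦*ᵖ⟧ (polynomial a) (polynomial b) n))
polynomial-correct (p at b) n =
  trans (cong ⟦ p ⟧ (polynomial-correct b n)) (sym (⟦∘ᵖ⟧ p (polynomial b) n))

-- Bounded execution

module _ {Q : Set} (O : Oracles Q) {k : ℕ} where

  Exec : Cmd Q k → Store k → ℕ → Store k → Set
  Exec c σ T τ = ∃[ n ] n ≤ T × Run O c σ n τ

module _ {Q : Set} {O : Oracles Q} {k : ℕ} where

  weaken : ∀ {c : Cmd Q k} {σ τ S T} → S ≤ T → Exec O c σ S τ → Exec O c σ T τ
  weaken S≤T (n , n≤S , r) = n , ≤-trans n≤S S≤T , r

  infixr 3 _⟫_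

  _⟫_ : ∀ {c d : Cmd Q k} {σ τ υ S T} →
    Exec O c σ S τ → Exec O d τ T υ → Exec O (c ⨾ d) σ (S + T) υ
  (m , m≤S , r) ⟫ (n , n≤T , s) = m + n , +-mono-≤ m≤S n≤T , seq r s

  ask-exec : ∀ {q x e} {σ : Store k} {t E A} →
    eval e σ ≡ t → time e σ ≤ E → size (O q t) ≤ A →
    Exec O (ask q x e) σ (1 + (E + A)) (σ [ x ]≔ O q t)
  ask-exec refl e≤ a≤ = _ , s≤s (+-mono-≤ e≤ a≤) , asks

  if-true-exec : ∀ {e} {c d : Cmd Q k} {σ τ a b E T} → eval e σ ≡ a ∙ b →
    time e σ ≤ E → Exec O c σ T τ → Exec O (ifte e c d) σ (1 + (E + T)) τ
  if-true-exec eq e≤ (n , n≤ , r) = _ , s≤s (+-mono-≤ e≤ n≤) , if-true eq r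

  if-false-exec : ∀ {e} {c d : Cmd Q k} {σ τ E T} → eval e σ ≡ nil →
    time e σ ≤ E → Exec O d σ T τ → Exec O (ifte e c d) σ (1 + (E + T)) τ
  if-false-exec eq e≤ (n , n≤ , r) = _ , s≤s (+-mono-≤ e≤ n≤) , if-false eq r

  -- The case `i = 0` of the bound in `while-step`, so that an induction on the number of passes can
  -- end here. Multiplication by 0 erases `D`, which is therefore given explicitly.
  while-stop : ∀ {e} {c : Cmd Q k} {σ E} D → eval e σ ≡ nil → time e σ ≤ E →
    Exec O (while e c) σ (0 * (1 + (E + D)) + (1 + E)) σ
  while-stop D eq e≤ = _ , s≤s e≤ , while-false eq

  while-step : ∀ {e} {c : Cmd Q k} {σ τ υ a b E D} i → eval e σ ≡ a ∙ b →
    time e σ ≤ E → Exec O c σ D τ →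
    Exec O (while e c) τ (i * (1 + (E + D)) + (1 + E)) υ →
    Exec O (while e c) σ (suc i * (1 + (E + D)) + (1 + E)) υ
  while-step {e} {c} {σ} {E = E} {D} i eq e≤ (m , m≤ , r) (n , n≤ , s) =
    _ , bound , while-true eq r s
    where
    open ≤-Reasoning
    T = i * (1 + (E + D)) + (1 + E)
    bound : suc (time e σ + (m + n)) ≤ suc i * (1 + (E + D)) + (1 + E)
    bound = begin
      suc (time e σ + (m + n))               ≤⟨ s≤s (+-mono-≤ e≤ (+-mono-≤ m≤ n≤)) ⟩
      suc (E + (D + T))                      ≡⟨ cong suc (sym (+-assoc E D T)) ⟩
      suc (E + D + T)                        ≡⟨ sym (+-assoc (suc (E + D)) _ (1 + E)) ⟩
      suc i * (1 + (E + D)) + (1 + E)        ∎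

-- Loop-free commands: functional semantics with symbolic size and cost bounds.

LoopFree : ∀ {Q k} → Cmd Q k → Set
LoopFree (x ≔ e)      = ⊤
LoopFree (ask q x e)  = ⊥
LoopFree (c ⨾ d)      = LoopFree c × LoopFree d
LoopFree (ifte e c d) = LoopFree c × LoopFree d
LoopFree (while e c)  = ⊥

branch : ∀ {A : Set} → Tree → A → A → A
branch nil     a b = b
branch (_ ∙ _) a b = a

-- On a concrete command `LoopFree` unfolds to a product of units, so its proof is inferred, and the
-- final store is found by computation.
exec : ∀ {Q k} (c : Cmd Q k) → {LoopFree c} → Store k → Store k
exec (x ≔ e)      σ = σ [ x ]≔ eval e σ
exec (c ⨾ d) {p , q} σ = exec d {q} (exec c {p} σ)
exec (ifte e c d) {p , q} σ = branch (eval e σ) (exec c {p} σ) (exec d {q} σ)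

timeBound : ∀ {k} → Expr k → Vec Bound k → Bound
timeBound (var x)    bs = Vec.lookup bs x
timeBound nil        bs = con 1
timeBound (cons e f) bs = con 1 ⊕ (timeBound e bs ⊕ timeBound f bs)
timeBound (hd e)     bs = con 1 ⊕ timeBound e bs
timeBound (tl e)     bs = con 1 ⊕ timeBound e bs

-- The time of an expression also bounds the size of its value, so `timeBound` serves as the new
-- size bound. Branches are joined by sums, as polynomials are not closed under maxima.
after : ∀ {Q k} → Cmd Q k → Vec Bound k → Vec Bound k
after (x ≔ e)      bs = bs [ x ]≔ timeBound e bs
after (c ⨾ d)      bs = after d (after c bs)
after (ifte e c d) bs = Vec.zipWith _⊕_ (after c bs) (after d bs)
after _            bs = bs

cost : ∀ {Q k} → Cmd Q k → Vec Bound k → Bound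
cost (x ≔ e)      bs = con 1 ⊕ timeBound e bs
cost (c ⨾ d)      bs = cost c bs ⊕ cost d (after c bs)
cost (ifte e c d) bs = con 1 ⊕ (timeBound e bs ⊕ (cost c bs ⊕ cost d bs))
cost _            bs = con 0

Fits : ∀ {k} → ℕ → Store k → Vec Bound k → Set
Fits n = Pointwise (λ t b → size t ≤ ⟪ b ⟫ n)

size-left : ∀ t → size (left t) ≤ suc (size t)
size-left nil     = s≤s z≤n
size-left (a ∙ b) = ≤-trans (m≤m+n (size a) (size b)) (≤-trans (n≤1+n _) (n≤1+n _))

size-right : ∀ t → size (right t) ≤ suc (size t)
size-right nil     = s≤s z≤n
size-right (a ∙ b) = ≤-trans (m≤n+m (size b) (size a)) (≤-trans (n≤1+n _) (n≤1+n _))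

-- Reading a variable is charged its full size, so the charge pays for every node of the result.
size-eval : ∀ {k} (e : Expr k) σ → size (eval e σ) ≤ time e σ
size-eval (var x)    σ = ≤-refl
size-eval nil        σ = ≤-refl
size-eval (cons e f) σ = s≤s (+-mono-≤ (size-eval e σ) (size-eval f σ))
size-eval (hd e)     σ = ≤-trans (size-left (eval e σ)) (s≤s (size-eval e σ))
size-eval (tl e)     σ = ≤-trans (size-right (eval e σ)) (s≤s (size-eval e σ))

module _ {n : ℕ} where

  time≤ : ∀ {k} (e : Expr k) {σ bs} → Fits n σ bs → time e σ ≤ ⟪ timeBound e bs ⟫ n
  time≤ (var x)    fits = Pointwise.lookup fits x
  time≤ nil        fits = ≤-refl
  time≤ (cons e f) fits = s≤s (+-mono-≤ (time≤ e fits) (time≤ f fits))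
  time≤ (hd e)     fits = s≤s (time≤ e fits)
  time≤ (tl e)     fits = s≤s (time≤ e fits)

  fits-update : ∀ {k} {σ : Store k} {bs t b} x → Fits n σ bs → size t ≤ ⟪ b ⟫ n →
    Fits n (σ [ x ]≔ t) (bs [ x ]≔ b)
  fits-update zero    (_ ∷ fs) t≤ = t≤ ∷ fs
  fits-update (suc x) (f ∷ fs) t≤ = f ∷ fits-update x fs t≤

  fits-⊕ˡ : ∀ {k} {σ : Store k} {bs} cs → Fits n σ bs → Fits n σ (Vec.zipWith _⊕_ bs cs)
  fits-⊕ˡ []       []       = []
  fits-⊕ˡ (c ∷ cs) (f ∷ fs) = ≤-trans f (m≤m+n _ _) ∷ fits-⊕ˡ cs fs

  fits-⊕ʳ : ∀ {k} {σ : Store k} bs {cs} → Fits n σ cs → Fits n σ (Vec.zipWith _⊕_ bs cs)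
  fits-⊕ʳ []       []       = []
  fits-⊕ʳ (b ∷ bs) (f ∷ fs) = ≤-trans f (m≤n+m _ _) ∷ fits-⊕ʳ bs fs

  module _ {Q : Set} where

    exec-after : ∀ {k} (c : Cmd Q k) {lf : LoopFree c} {σ bs} → Fits n σ bs →
      Fits n (exec c {lf} σ) (after c bs)
    exec-after (x ≔ e) {σ = σ} fits =
      fits-update x fits (≤-trans (size-eval e σ) (time≤ e fits))
    exec-after (c ⨾ d) fits = exec-after d (exec-after c fits)
    exec-after (ifte e c d) {σ = σ} fits with eval e σ
    ... | nil   = fits-⊕ʳ _ (exec-after d fits)
    ... | _ ∙ _ = fits-⊕ˡ _ (exec-after c fits)

    straight : ∀ {O : Oracles Q} {k} (c : Cmd Q k) {lf : LoopFree c} {σ} bs → Fits n σ bs →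
      Exec O c σ (⟪ cost c bs ⟫ n) (exec c {lf} σ)
    straight (x ≔ e) bs fits = _ , s≤s (time≤ e fits) , assign
    straight (c ⨾ d) bs fits = straight c bs fits ⟫ straight d (after c bs) (exec-after c fits)
    straight (ifte e c d) {σ = σ} bs fits with eval e σ in eq
    ... | nil   = weaken (s≤s (+-monoʳ-≤ (⟪ timeBound e bs ⟫ n) (m≤n+m _ (⟪ cost c bs ⟫ n))))
                    (if-false-exec eq (time≤ e fits) (straight d bs fits))
    ... | _ ∙ _ = weaken (s≤s (+-monoʳ-≤ (⟪ timeBound e bs ⟫ n) (m≤m+n (⟪ cost c bs ⟫ n) _)))
                    (if-true-exec eq (time≤ e fits) (straight c bs fits))

constant : ∀ {k} → Tree → Expr k
constant nil     = nil
constant (a ∙ b) = cons (constant a) (constant b)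

eval-constant : ∀ {k} t (σ : Store k) → eval (constant t) σ ≡ t
eval-constant nil     σ = refl
eval-constant (a ∙ b) σ = cong₂ _∙_ (eval-constant a σ) (eval-constant b σ)

time-constant : ∀ {k} t (σ : Store k) → time (constant t) σ ≡ size t
time-constant nil     σ = refl
time-constant (a ∙ b) σ = cong suc (cong₂ _+_ (time-constant a σ) (time-constant b σ))

-- Unary numbers and evaluation of polynomials

size-unary : ∀ v → size (unary v) ≡ 1 + 2 * v
size-unary zero    = refl
size-unary (suc v) = trans (cong (λ s → suc (1 + s)) (size-unary v)) (lemma v)
  where
  lemma : ∀ v → suc (1 + (1 + 2 * v)) ≡ 1 + 2 * suc v
  lemma = solve-∀

unaryBound : Bound → Bound
unaryBound b = con 1 ⊕ (con 2 ⊗ b)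

unary≤ : ∀ n b {v} → v ≤ ⟪ b ⟫ n → size (unary v) ≤ ⟪ unaryBound b ⟫ n
unary≤ n b {v} v≤ rewrite size-unary v = s≤s (*-monoʳ-≤ 2 v≤)

-- Unfolds to the bound of `while-step` with `count` passes; the last summand is the failing test.
loopBound : Bound → Bound → Bound → Bound
loopBound count test body = (count ⊗ (con 1 ⊕ (test ⊕ body))) ⊕ (con 1 ⊕ test)

module Horner {Q : Set} {r : ℕ} where

  𝑁 𝑅 𝑇 𝐼 𝐽 : Fin (6 + r)
  𝑁 = suc zero
  𝑅 = suc (suc zero)
  𝑇 = suc (suc (suc zero))
  𝐼 = suc (suc (suc (suc zero)))
  𝐽 = suc (suc (suc (suc (suc zero))))

  prepare : ℕ → Cmd Q (6 + r)
  prepare a = 𝑇 ≔ var 𝑅 ⨾ 𝑅 ≔ constant (unary a) ⨾ 𝐼 ≔ var 𝑁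

  bump add row rows : Cmd Q (6 + r)
  bump = 𝑅 ≔ cons nil (var 𝑅) ⨾ 𝐽 ≔ tl (var 𝐽)
  add  = while (var 𝐽) bump
  row  = 𝐽 ≔ var 𝑇 ⨾ add ⨾ 𝐼 ≔ tl (var 𝐼)
  rows = while (var 𝐼) row

  -- Horner's rule with multiplication as repeated increment: starting from `a`, each of the `n`
  -- rows adds the copy in `𝑇` of the value of `p`. The loops use up `𝐼` and `𝐽`, and the last
  -- assignment clears `𝑇`, so each level of the recursion ends with nil working variables.
  horner : Polynomial → Cmd Q (6 + r)
  horner []      = 𝑅 ≔ nil
  horner (a ∷ p) = horner p ⨾ prepare a ⨾ rows ⨾ 𝑇 ≔ nil

  module _ (bx : Bound) (bρ : Vec Bound r) where

    bounds : Bound → Bound → Bound → Bound → Vec Bound (6 + r)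
    bounds v t i j = bx ∷ unaryBound 𝕟 ∷ v ∷ t ∷ i ∷ j ∷ bρ

    clean : Bound → Vec Bound (6 + r)
    clean bv = bounds bv (con 1) (con 1) (con 1)

    bu : Polynomial → Bound
    bu p = unaryBound (p at 𝕟)

    -- One vector that stays valid during all passes of both loops, so that every pass has the same
    -- cost bound.
    loopBounds : ℕ → Polynomial → Vec Bound (6 + r)
    loopBounds a p = bounds (bu (a ∷ p)) (bu p) (unaryBound 𝕟) (bu p)

    bumpTime addTime rowTime rowsTime : ℕ → Polynomial → Bound
    bumpTime a p = cost bump (loopBounds a p)
    addTime a p  = loopBound (p at 𝕟) (bu p) (bumpTime a p)
    rowTime a p  =
      cost {Q} (𝐽 ≔ var 𝑇) (loopBounds a p) ⊕ addTime a p
        ⊕ cost {Q} (𝐼 ≔ tl (var 𝐼)) (loopBounds a p)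
    rowsTime a p = loopBound 𝕟 (unaryBound 𝕟) (rowTime a p)

    hornerTime : Polynomial → Bound
    hornerTime []      = con 2
    hornerTime (a ∷ p) =
      hornerTime p ⊕ cost (prepare a) (clean (bu p)) ⊕ rowsTime a p
        ⊕ cost {Q} (𝑇 ≔ nil) (loopBounds a p)

    module _ {O : Oracles Q} (x : Tree) (n : ℕ) (ρ : Store r)
             (x≤ : size x ≤ ⟪ bx ⟫ n) (ρ≤ : Fits n ρ bρ) where

      state : Tree → Tree → Tree → Tree → Store (6 + r)
      state v t i j = x ∷ unary n ∷ v ∷ t ∷ i ∷ j ∷ ρ

      fits : ∀ {v t i j bv bt bi bj} → size v ≤ ⟪ bv ⟫ n → size t ≤ ⟪ bt ⟫ n →
        size i ≤ ⟪ bi ⟫ n → size j ≤ ⟪ bj ⟫ n → Fits n (state v t i j) (bounds bv bt bi bj)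
      fits v≤ t≤ i≤ j≤ = x≤ ∷ unary≤ n 𝕟 ≤-refl ∷ v≤ ∷ t≤ ∷ i≤ ∷ j≤ ∷ ρ≤

      module _ (a : ℕ) (p : Polynomial) where

        u V : ℕ
        u = ⟦ p ⟧ n
        V = a + n * u

        fits-loop : ∀ {v i j} → v ≤ V → i ≤ n → j ≤ u →
          Fits n (state (unary v) (unary u) (unary i) (unary j)) (loopBounds a p)
        fits-loop v≤ i≤ j≤ =
          fits (unary≤ n ((a ∷ p) at 𝕟) v≤) (unary≤ n (p at 𝕟) ≤-refl)
               (unary≤ n 𝕟 i≤) (unary≤ n (p at 𝕟) j≤)

        add-exec : ∀ j v i {w} → i ≤ n → j ≤ u → w ≤ V → j + v ≡ w →
          Exec O add (state (unary v) (unary u) (unary i) (unary j))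
               (j * (1 + (⟪ bu p ⟫ n + ⟪ bumpTime a p ⟫ n)) + (1 + ⟪ bu p ⟫ n))
               (state (unary w) (unary u) (unary i) nil)
        add-exec zero    v i i≤ j≤ w≤ refl =
          while-stop (⟪ bumpTime a p ⟫ n) refl (unary≤ n (p at 𝕟) j≤)
        add-exec (suc j) v i i≤ j≤ w≤ refl =
          while-step j refl (unary≤ n (p at 𝕟) j≤)
            (straight bump (loopBounds a p) (fits-loop (≤-trans (m≤n+m v (suc j)) w≤) i≤ j≤))
            (add-exec j (suc v) i i≤ (≤-trans (n≤1+n j) j≤) w≤ (+-suc j v))

        -- Invariant: the `i` rows still to come are worth `i * u`, and together with the value
        -- reached they make up `V`. Hence every intermediate value is at most `V`.
        rows-exec : ∀ i v → i ≤ n → i * u + v ≡ V →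
          Exec O rows (state (unary v) (unary u) (unary i) nil)
               (i * (1 + (⟪ unaryBound 𝕟 ⟫ n + ⟪ rowTime a p ⟫ n)) + (1 + ⟪ unaryBound 𝕟 ⟫ n))
               (state (unary V) (unary u) nil nil)
        rows-exec zero    v i≤ refl = while-stop (⟪ rowTime a p ⟫ n) refl (unary≤ n 𝕟 i≤)
        rows-exec (suc i) v i≤ eq =
          while-step i refl (unary≤ n 𝕟 i≤)
            (straight (𝐽 ≔ var 𝑇) (loopBounds a p)
                (fits-loop (≤-trans (m≤n+m v (suc i * u)) (≤-reflexive eq)) i≤ z≤n)
              ⟫ add-exec u v (suc i) i≤ ≤-refl uv≤ refl
              ⟫ straight (𝐼 ≔ tl (var 𝐼)) (loopBounds a p) (fits-loop uv≤ i≤ z≤n))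
            (rows-exec i (u + v) (≤-trans (n≤1+n i) i≤) eq′)
          where
          shuffle : ∀ s t v → t + (s + v) ≡ s + t + v
          shuffle = solve-∀
          eq′ : i * u + (u + v) ≡ V
          eq′ = trans (shuffle u (i * u) v) eq
          uv≤ : u + v ≤ V
          uv≤ = ≤-trans (m≤n+m _ (i * u)) (≤-reflexive eq′)

      horner-exec : ∀ p → Exec O (horner p) (state nil nil nil nil) (⟪ hornerTime p ⟫ n)
                            (state (unary (⟦ p ⟧ n)) nil nil nil)
      horner-exec []      =
        straight (𝑅 ≔ nil) (clean (con 1)) (fits ≤-refl ≤-refl ≤-refl ≤-refl)
      horner-exec (a ∷ p) =
        horner-exec p
          -- For a variable `a`, the constant expression evaluates to `unary a` only
          -- propositionally.
          ⟫ subst (λ t → Exec O (prepare a) (state (unary (u a p)) nil nil nil)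
                     (⟪ cost (prepare a) (clean (bu p)) ⟫ n)
                     (state t (unary (u a p)) (unary n) nil))
              (eval-constant (unary a) (state (unary (u a p)) (unary (u a p)) nil nil))
              (straight (prepare a) (clean (bu p))
                (fits (unary≤ n (p at 𝕟) ≤-refl) ≤-refl ≤-refl ≤-refl))
          ⟫ rows-exec a p n a ≤-refl (+-comm (n * u a p) a)
          ⟫ straight (𝑇 ≔ nil) (loopBounds a p) (fits-loop a p ≤-refl z≤n z≤n)

-- The network

-- Being total, it lets arcs be listed as pairs of plain numbers; the bounds are supplied later by
-- `Descending`, under which it loses nothing.
clamp : ∀ K → ℕ → Fin (suc K)
clamp K       zero    = zero
clamp zero    (suc a) = zero
clamp (suc K) (suc a) = suc (clamp K a)

toℕ-clamp : ∀ {K a} → a ≤ K → toℕ (clamp K a) ≡ a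
toℕ-clamp z≤n       = refl
toℕ-clamp (s≤s a≤K) = cong suc (toℕ-clamp a≤K)

arc : ∀ K → ℕ × ℕ → Fin (suc K) × Fin (suc K)
arc K (a , b) = clamp K a , clamp K b

level : ℕ → ℕ
level zero    = 0
level (suc j) = 3 + level j

-- Three routes lead from node 3 + l to node l, where l = level j: via 1 + l,
-- via 2 + l, and directly.  They stand for appending true, appending false and
-- appending nothing to the witness.
stage : ℕ → List (ℕ × ℕ) → List (ℕ × ℕ)
stage l xs =
  (3 + l , 1 + l) ∷ (3 + l , 2 + l) ∷ (1 + l , l) ∷ (2 + l , l) ∷ (3 + l , l) ∷ xs

stages : ℕ → List (ℕ × ℕ)
stages zero    = []
stages (suc j) = stage (level j) (stages j)

-- The entrance to the stages, preceded by a direct link from the source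
-- 2 + l to the destination 0.
entry : ℕ → List (ℕ × ℕ) → List (ℕ × ℕ)
entry l xs = (2 + l , 0) ∷ (2 + l , 1 + l) ∷ (1 + l , l) ∷ xs

top : ℕ → ℕ
top m = 2 + level m

arcs : ℕ → List (ℕ × ℕ)
arcs m = entry (level m) (stages m)

-- Strict descent makes walks simple and short. The upper bound on tails keeps newly added arcs
-- different from old ones and shows that no stage link leaves the source or the gate.
Descending : ℕ → ℕ × ℕ → Set
Descending K (a , b) = b < a × a ≤ K

raise : ∀ {K K′ xs} → K ≤ K′ → All (Descending K) xs → All (Descending K′) xs
raise K≤K′ = All.map (λ (b<a , a≤K) → b<a , ≤-trans a≤K K≤K′)

stages-descending : ∀ j → All (Descending (level j)) (stages j)
stages-descending zero    = []
stages-descending (suc j) =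
  (m<n+m _ {2} (s≤s z≤n) , ≤-refl) ∷
  (n<1+n _ , ≤-refl) ∷
  (n<1+n _ , m≤n+m _ 2) ∷
  (m<n+m _ {2} (s≤s z≤n) , n≤1+n _) ∷
  (m<n+m _ {3} (s≤s z≤n) , ≤-refl) ∷
  raise (m≤n+m _ 3) (stages-descending j)

arcs-descending : ∀ m → All (Descending (top m)) (arcs m)
arcs-descending m =
  (s≤s z≤n , ≤-refl) ∷ (n<1+n _ , ≤-refl) ∷ (n<1+n _ , n≤1+n _) ∷
  raise (m≤n+m _ 2) (stages-descending m)

fresh : ∀ {K a b xs} → K < a → All (Descending K) xs → All ((a , b) ≢_) xs
fresh K<a = All.map λ { (_ , a≤K) refl → <-irrefl refl (≤-trans K<a a≤K) }

stage-unique : ∀ l {xs} → All (Descending l) xs → Unique xs → Unique (stage l xs)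
stage-unique l desc uniq =
  ((λ ()) ∷ (λ ()) ∷ (λ ()) ∷ (λ ()) ∷ fresh (m<n+m l {3} (s≤s z≤n)) desc) ∷
  ((λ ()) ∷ (λ ()) ∷ (λ ()) ∷ fresh (m<n+m l {3} (s≤s z≤n)) desc) ∷
  ((λ ()) ∷ (λ ()) ∷ fresh (n<1+n l) desc) ∷
  ((λ ()) ∷ fresh (m<n+m l {2} (s≤s z≤n)) desc) ∷
  fresh (m<n+m l {3} (s≤s z≤n)) desc ∷
  uniq

entry-unique : ∀ l {xs} → All (Descending l) xs → Unique xs → Unique (entry l xs)
entry-unique l desc uniq =
  ((λ ()) ∷ (λ ()) ∷ fresh (m<n+m l {2} (s≤s z≤n)) desc) ∷
  ((λ ()) ∷ fresh (m<n+m l {2} (s≤s z≤n)) desc) ∷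
  fresh (n<1+n l) desc ∷
  uniq

stages-unique : ∀ j → Unique (stages j)
stages-unique zero    = []
stages-unique (suc j) = stage-unique (level j) (stages-descending j) (stages-unique j)

arcs-unique : ∀ m → Unique (arcs m)
arcs-unique m = entry-unique (level m) (stages-descending m) (stages-unique m)

-- `arc K` is not injective on all pairs. But reading the numbers back restores this list, and
-- distinctness is reflected along any map.
map-arc-unique : ∀ {K xs} → All (Descending K) xs → Unique xs → Unique (map (arc K) xs)
map-arc-unique {K} {xs} desc uniq =
  Uniqueₚ.map⁻ {f = numbers} (subst Unique (sym (restore desc)) uniq)
  where
  numbers : Fin (suc K) × Fin (suc K) → ℕ × ℕ
  numbers (u , v) = toℕ u , toℕ v
  restore : ∀ {xs} → All (Descending K) xs → map numbers (map (arc K) xs) ≡ xs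
  restore []                    = refl
  restore ((b<a , a≤K) ∷ desc) =
    cong₂ _∷_ (cong₂ _,_ (toℕ-clamp a≤K) (toℕ-clamp (≤-trans (<⇒≤ b<a) a≤K))) (restore desc)

map-arc-descending : ∀ {K K′ xs} → K ≤ K′ → All (Descending K) xs →
  All (λ (u , v) → Descending K (toℕ u , toℕ v)) (map (arc K′) xs)
map-arc-descending {K} {K′} K≤K′ desc = Allₚ.map⁺ (All.map step desc)
  where
  step : ∀ {p} → Descending K p →
    Descending K (toℕ (proj₁ (arc K′ p)) , toℕ (proj₂ (arc K′ p)))
  step {a , b} (b<a , a≤K)
    rewrite toℕ-clamp (≤-trans a≤K K≤K′) | toℕ-clamp (≤-trans (<⇒≤ b<a) (≤-trans a≤K K≤K′))
    = b<a , a≤K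

network : ℕ → Network
network m = record
  { N        = suc (top m)
  ; links    = map (arc (top m)) (arcs m)
  ; distinct = map-arc-unique (arcs-descending m) (arcs-unique m)
  }

module _ {A : Set} where

  -- `IsWalk` over an arbitrary list of links, so that walks can be carried along when links are put
  -- in front.
  Walk : (xs : List (A × A)) → A → List (Fin (length xs)) → A → Set
  Walk xs u []       v = u ≡ v
  Walk xs u (i ∷ is) v = proj₁ (List.lookup xs i) ≡ u × Walk xs (proj₂ (List.lookup xs i)) is v

  walk-suc : ∀ {x xs u v} is → Walk xs u is v → Walk (x ∷ xs) u (map suc is) v
  walk-suc []       w       = w
  walk-suc (i ∷ is) (e , w) = e , walk-suc is w

shift³ : ∀ {k} → List (Fin k) → List (Fin (3 + k))
shift³ is = map suc (map suc (map suc is))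

shift⁵ : ∀ {k} → List (Fin k) → List (Fin (5 + k))
shift⁵ is = map suc (map suc (shift³ is))

walk-shift³ : ∀ {A : Set} {x₁ x₂ x₃} {xs : List (A × A)} {u v} is → Walk xs u is v →
  Walk (x₁ ∷ x₂ ∷ x₃ ∷ xs) u (shift³ is) v
walk-shift³ is w = walk-suc _ (walk-suc _ (walk-suc is w))

walk-shift⁵ : ∀ {A : Set} {x₁ x₂ x₃ x₄ x₅} {xs : List (A × A)} {u v} is → Walk xs u is v →
  Walk (x₁ ∷ x₂ ∷ x₃ ∷ x₄ ∷ x₅ ∷ xs) u (shift⁵ is) v
walk-shift⁵ is w = walk-suc _ (walk-suc _ (walk-shift³ is w))

linkSet : ∀ {k} → List (Fin k) → Subset k
linkSet is = ⋃ (map ⁅_⁆ is)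

linkSet-suc : ∀ {k} (is : List (Fin k)) → linkSet (map suc is) ≡ false ∷ linkSet is
linkSet-suc []       = refl
linkSet-suc (i ∷ is) rewrite linkSet-suc is = refl

linkSet-shift³ : ∀ {k} (is : List (Fin k)) →
  linkSet (shift³ is) ≡ false ∷ false ∷ false ∷ linkSet is
linkSet-shift³ is
  rewrite linkSet-suc (map suc (map suc is)) | linkSet-suc (map suc is) | linkSet-suc is = refl

linkSet-shift⁵ : ∀ {k} (is : List (Fin k)) →
  linkSet (shift⁵ is) ≡ false ∷ false ∷ false ∷ false ∷ false ∷ linkSet is
linkSet-shift⁵ is
  rewrite linkSet-suc (map suc (shift³ is)) | linkSet-suc (shift³ is) | linkSet-shift³ is = refl

module Witness (K : ℕ) where

  StageLinks : ℕ → ℕ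
  StageLinks j = length (map (arc K) (stages j))

  stageLinks≡ : ∀ j → StageLinks j ≡ j * 5
  stageLinks≡ zero    = refl
  stageLinks≡ (suc j) = cong (5 +_) (stageLinks≡ j)

  -- Total on arbitrary sets, since non-paths are priced too. The first two bits of each group of
  -- five settle the choice. Bits are pushed on the front, as the program `scan` does, so a witness
  -- comes out reversed.
  decode : ∀ j → Subset (StageLinks j) → List Bool → List Bool
  decode zero    []                                u = u
  decode (suc j) (true  ∷ _     ∷ _ ∷ _ ∷ _ ∷ S) u = decode j S (true ∷ u)
  decode (suc j) (false ∷ true  ∷ _ ∷ _ ∷ _ ∷ S) u = decode j S (false ∷ u)
  decode (suc j) (false ∷ false ∷ _ ∷ _ ∷ _ ∷ S) u = decode j S u

  -- Holds for every set of links, so an accepted set yields a witness of legal length whatever its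
  -- shape.
  length-decode : ∀ j S u → length (decode j S u) ≤ j + length u
  length-decode zero    []                                u = ≤-refl
  length-decode (suc j) (true  ∷ _     ∷ _ ∷ _ ∷ _ ∷ S) u =
    ≤-trans (length-decode j S (true ∷ u)) (≤-reflexive (+-suc j (length u)))
  length-decode (suc j) (false ∷ true  ∷ _ ∷ _ ∷ _ ∷ S) u =
    ≤-trans (length-decode j S (false ∷ u)) (≤-reflexive (+-suc j (length u)))
  length-decode (suc j) (false ∷ false ∷ _ ∷ _ ∷ _ ∷ S) u =
    m≤n⇒m≤1+n (length-decode j S u)

  route : ∀ j → List Bool → List (Fin (StageLinks j))
  route zero    v           = []
  route (suc j) []          = suc (suc (suc (suc zero))) ∷ shift⁵ (route j [])
  route (suc j) (true ∷ v)  = zero ∷ suc (suc zero) ∷ shift⁵ (route j v)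
  route (suc j) (false ∷ v) = suc zero ∷ suc (suc (suc zero)) ∷ shift⁵ (route j v)

  route-walk : ∀ j v → Walk (map (arc K) (stages j)) (clamp K (level j)) (route j v) zero
  route-walk zero    v           = refl
  route-walk (suc j) []          = refl , walk-shift⁵ _ (route-walk j [])
  route-walk (suc j) (true ∷ v)  = refl , refl , walk-shift⁵ _ (route-walk j v)
  route-walk (suc j) (false ∷ v) = refl , refl , walk-shift⁵ _ (route-walk j v)

  -- The fold is `reverse` with an accumulator: for `u = []` the right side is `reverse v`.
  decode-route : ∀ j v u → length v ≤ j →
    decode j (linkSet (route j v)) u ≡ foldl (λ bs b → b ∷ bs) u v
  decode-route zero    []          u v≤ = refl
  decode-route (suc j) []          u v≤
    rewrite linkSet-shift⁵ (route j []) | ∪-identityˡ (linkSet (route j []))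
    = decode-route j [] u z≤n
  decode-route (suc j) (true ∷ v)  u (s≤s v≤)
    -- Each of the two links of this stage leaves an empty set in the union over the later stages,
    -- hence two identity rewrites.
    rewrite linkSet-shift⁵ (route j v) | ∪-identityˡ (linkSet (route j v))
          | ∪-identityˡ (linkSet (route j v))
    = decode-route j v (true ∷ u) v≤
  decode-route (suc j) (false ∷ v) u (s≤s v≤)
    rewrite linkSet-shift⁵ (route j v) | ∪-identityˡ (linkSet (route j v))
          | ∪-identityˡ (linkSet (route j v))
    = decode-route j v (false ∷ u) v≤

-- The model

2ℚ : ℚ
2ℚ = 1ℚ ℚ.+ 1ℚ

module Model (m : ℕ) (accepts : List Bool → Bool) where

  open Network (network m) using (L)
  open Witness (top m) public

  weight : Fin L → ℚ
  weight zero          = 1ℚ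
  weight (suc zero)    = 1ℚ
  weight (suc (suc _)) = 0ℚ

  verdictRatio : Bool → ℚ
  verdictRatio true  = ½
  verdictRatio false = 2ℚ

  -- Differs from 1 only on sets that contain both entrance links, hence have at least two elements,
  -- where a coefficient takes effect.
  ratio : Subset L → ℚ
  ratio (false ∷ true ∷ true ∷ S) = verdictRatio (accepts (decode m S []))
  ratio _                         = 1ℚ

  verdictRatio>0 : ∀ b → 0ℚ ℚ.< verdictRatio b
  verdictRatio>0 true  = from-yes (0ℚ ℚ.<? ½)
  verdictRatio>0 false = from-yes (0ℚ ℚ.<? 2ℚ)

  model : Correlated L
  model = record { w = weight ; ρ = ratio ; w≥0 = w≥0 ; ρ>0 = λ S _ → ratio>0 S }
    where
    0<1 : 0ℚ ℚ.< 1ℚ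
    0<1 = from-yes (0ℚ ℚ.<? 1ℚ)
    w≥0 : ∀ l → 0ℚ ℚ.≤ weight l
    w≥0 zero          = ℚₚ.<⇒≤ 0<1
    w≥0 (suc zero)    = ℚₚ.<⇒≤ 0<1
    w≥0 (suc (suc _)) = ℚₚ.≤-refl
    ratio>0 : ∀ S → 0ℚ ℚ.< ratio S
    ratio>0 (true  ∷ _     ∷ _     ∷ _) = 0<1
    ratio>0 (false ∷ false ∷ _     ∷ _) = 0<1
    ratio>0 (false ∷ true  ∷ false ∷ _) = 0<1
    ratio>0 (false ∷ true  ∷ true  ∷ S) = verdictRatio>0 (accepts (decode m S []))

  open Correlated model using (total; jointCost)

  price : Subset L → ℚ
  price (true  ∷ true  ∷ _     ∷ _) = 2ℚ
  price (true  ∷ false ∷ _     ∷ _) = 1ℚ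
  price (false ∷ false ∷ _     ∷ _) = 0ℚ
  price (false ∷ true  ∷ false ∷ _) = 1ℚ
  price (false ∷ true  ∷ true  ∷ S) = verdictRatio (accepts (decode m S []))

  sum-zeros : ∀ {ls} → All (λ l → weight l ≡ 0ℚ) ls → sumℚ (map weight ls) ≡ 0ℚ
  sum-zeros []       = refl
  sum-zeros (z ∷ zs) = cong₂ ℚ._+_ z (sum-zeros zs)

  light : ∀ S → sumℚ (map weight (filter (_∈? S) (List.tabulate (λ i → suc (suc i))))) ≡ 0ℚ
  light S = sum-zeros (Allₚ.filter⁺ (_∈? S) (Allₚ.tabulate⁺ {f = λ i → suc (suc i)} (λ _ → refl)))

  total≡ : ∀ b c S → total (b ∷ c ∷ S)
    ≡ (if b then 1ℚ else 0ℚ) ℚ.+ (if c then 1ℚ else 0ℚ)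
  total≡ true  true  S = cong (λ q → 1ℚ ℚ.+ (1ℚ ℚ.+ q)) (light (true ∷ true ∷ S))
  total≡ true  false S = cong (1ℚ ℚ.+_) (light (true ∷ false ∷ S))
  total≡ false true  S = cong (1ℚ ℚ.+_) (light (false ∷ true ∷ S))
  total≡ false false S = light (false ∷ false ∷ S)

  -- With coefficient 1 both branches of `jointCost` agree, so the cardinality test need not be
  -- decided.
  uncorrelated : ∀ c q {r} → q ≡ r → (if c then 1ℚ ℚ.* q else q) ≡ r
  uncorrelated true  q refl = ℚₚ.*-identityˡ q
  uncorrelated false q refl = refl

  jointCost≡price : ∀ S → jointCost S ≡ price S
  jointCost≡price (true  ∷ true  ∷ d ∷ S) = uncorrelated _ _ (total≡ true true (d ∷ S))
  jointCost≡price (true  ∷ false ∷ d ∷ S) = uncorrelated _ _ (total≡ true false (d ∷ S))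
  jointCost≡price (false ∷ false ∷ d ∷ S) = uncorrelated _ _ (total≡ false false (d ∷ S))
  jointCost≡price (false ∷ true  ∷ false ∷ S) = uncorrelated _ _ (total≡ false true (false ∷ S))
  jointCost≡price (false ∷ true  ∷ true  ∷ S) =
    -- Two members are visible, so the cardinality test computes to true and the coefficient
    -- multiplies a total of 1.
    trans (cong (verdictRatio (accepts (decode m S [])) ℚ.*_) (total≡ false true (true ∷ S)))
          (ℚₚ.*-identityʳ _)

-- The evaluator

bitsBound : Bound → Bound
bitsBound b = con 1 ⊕ con 4 ⊗ b

codeBits≤ : ∀ n b l → length l ≤ ⟪ b ⟫ n → size (codeBits l) ≤ ⟪ bitsBound b ⟫ n
codeBits≤ n b l l≤ = ≤-trans (bound l) (s≤s (*-monoʳ-≤ 4 l≤))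
  where
  size-codeBool : ∀ b → size (codeBool b) ≤ 3
  size-codeBool true  = ≤-refl
  size-codeBool false = s≤s z≤n
  bound : ∀ l → size (codeBits l) ≤ 1 + 4 * length l
  bound []      = ≤-refl
  bound (b ∷ l) = ≤-trans (s≤s (+-mono-≤ (size-codeBool b) (bound l)))
                          (≤-reflexive (lemma (length l)))
    where
    lemma : ∀ k → suc (3 + (1 + 4 * k)) ≡ 1 + 4 * suc k
    lemma = solve-∀

module _ {v : ℕ} where

  -- Makes room for `𝐴` and `𝐵` behind variable zero, which stays shared: the verifier gets its
  -- input and leaves its verdict in `𝑋`.
  embed : Fin (suc v) → Fin (3 + v)
  embed zero    = zero
  embed (suc i) = suc (suc (suc i))

  embedExpr : Expr (suc v) → Expr (3 + v)
  embedExpr (var i)    = var (embed i)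
  embedExpr nil        = nil
  embedExpr (cons e f) = cons (embedExpr e) (embedExpr f)
  embedExpr (hd e)     = hd (embedExpr e)
  embedExpr (tl e)     = tl (embedExpr e)

  embedCmd : ∀ {Q} → Cmd Q (suc v) → Cmd Q (3 + v)
  embedCmd (i ≔ e)      = embed i ≔ embedExpr e
  embedCmd (ask q i e)  = ask q (embed i) (embedExpr e)
  embedCmd (c ⨾ d)      = embedCmd c ⨾ embedCmd d
  embedCmd (ifte e c d) = ifte (embedExpr e) (embedCmd c) (embedCmd d)
  embedCmd (while e c)  = while (embedExpr e) (embedCmd c)

  module _ (a b : Tree) where

    embedStore : Store (suc v) → Store (3 + v)
    embedStore (x ∷ σ) = x ∷ a ∷ b ∷ σ

    lookup-embed : ∀ i σ → Vec.lookup (embedStore σ) (embed i) ≡ Vec.lookup σ i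
    lookup-embed zero    (x ∷ σ) = refl
    lookup-embed (suc i) (x ∷ σ) = refl

    update-embed : ∀ i t σ → embedStore σ [ embed i ]≔ t ≡ embedStore (σ [ i ]≔ t)
    update-embed zero    t (x ∷ σ) = refl
    update-embed (suc i) t (x ∷ σ) = refl

    eval-embed : ∀ e σ → eval (embedExpr e) (embedStore σ) ≡ eval e σ
    eval-embed (var i)    σ = lookup-embed i σ
    eval-embed nil        σ = refl
    eval-embed (cons e f) σ = cong₂ _∙_ (eval-embed e σ) (eval-embed f σ)
    eval-embed (hd e)     σ = cong left (eval-embed e σ)
    eval-embed (tl e)     σ = cong right (eval-embed e σ)

    time-embed : ∀ e σ → time (embedExpr e) (embedStore σ) ≡ time e σ
    time-embed (var i)    σ = cong size (lookup-embed i σ)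
    time-embed nil        σ = refl
    time-embed (cons e f) σ = cong suc (cong₂ _+_ (time-embed e σ) (time-embed f σ))
    time-embed (hd e)     σ = cong suc (time-embed e σ)
    time-embed (tl e)     σ = cong suc (time-embed e σ)

    -- Time is preserved exactly, so the verifier's own polynomial still applies.
    run-embed : ∀ {Q} {O : Oracles Q} {c σ n τ} → Run O c σ n τ →
      Run O (embedCmd c) (embedStore σ) n (embedStore τ)
    run-embed (assign {x} {e} {σ})
      rewrite sym (update-embed x (eval e σ) σ) | sym (eval-embed e σ) | sym (time-embed e σ)
      = assign
    run-embed {O = O} (asks {q} {x} {e} {σ})
      rewrite sym (update-embed x (O q (eval e σ)) σ) | sym (eval-embed e σ) | sym (time-embed e σ)
      = asks
    run-embed (seq r s) = seq (run-embed r) (run-embed s)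
    run-embed (if-true {e} {σ = σ} eq r)
      rewrite sym (time-embed e σ) = if-true (trans (eval-embed e σ) eq) (run-embed r)
    run-embed (if-false {e} {σ = σ} eq r)
      rewrite sym (time-embed e σ) = if-false (trans (eval-embed e σ) eq) (run-embed r)
    run-embed (while-true {e} {σ = σ} eq r s)
      rewrite sym (time-embed e σ) =
      while-true (trans (eval-embed e σ) eq) (run-embed r) (run-embed s)
    run-embed (while-false {e} {σ = σ} eq)
      rewrite sym (time-embed e σ) = while-false (trans (eval-embed e σ) eq)

module Evaluator {A : Language} (np : NP A) where

  open NP np
  open Program verifier renaming (body to verify)

  k : ℕ
  k = 3 + vars

  𝑋 𝐴 𝐵 : Fin k
  𝑋 = zero
  𝐴 = suc zero
  𝐵 = suc (suc zero)

  codeTrue : Tree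
  codeTrue = codeBool true

  -- Afterwards either 𝐵 holds the cost, or 𝐵 is nil and the cost depends on
  -- the witness encoded in 𝐴.
  dispatch scan finish main eval-body : Cmd ⊥ k
  dispatch =
    𝐴 ≔ tl (var 𝑋) ⨾ 𝑋 ≔ hd (var 𝑋) ⨾
    ifte (hd (var 𝐴))
      (ifte (hd (tl (var 𝐴))) (𝐵 ≔ constant (codeℚ 2ℚ)) (𝐵 ≔ constant (codeℚ 1ℚ)))
      (ifte (hd (tl (var 𝐴)))
        (ifte (hd (tl (tl (var 𝐴)))) (𝐴 ≔ tl (tl (tl (var 𝐴)))) (𝐵 ≔ constant (codeℚ 1ℚ)))
        (𝐵 ≔ constant (codeℚ 0ℚ)))
  scan =
    ifte (hd (var 𝐴)) (𝐵 ≔ cons (constant codeTrue) (var 𝐵))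
      (ifte (hd (tl (var 𝐴))) (𝐵 ≔ cons nil (var 𝐵)) (𝐵 ≔ var 𝐵)) ⨾
    𝐴 ≔ tl (tl (tl (tl (tl (var 𝐴)))))
  finish = ifte (var 𝑋) (𝑋 ≔ constant (codeℚ ½)) (𝑋 ≔ constant (codeℚ 2ℚ))
  main = while (var 𝐴) scan ⨾ 𝑋 ≔ cons (var 𝑋) (var 𝐵) ⨾ embedCmd verify ⨾ finish
  eval-body = dispatch ⨾ ifte (var 𝐵) (𝑋 ≔ var 𝐵) main

  evaluator : Program ⊥
  evaluator = program (2 + vars) eval-body

  M groupBound : Bound
  M = witnessLength at 𝕟
  groupBound = bitsBound (M ⊗ con 5)

  startBounds loopBounds : Vec Bound k
  startBounds =
    (con 1 ⊕ (bitsBound 𝕟 ⊕ bitsBound (con 3 ⊕ M ⊗ con 5))) ∷ con 1 ∷ con 1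
      ∷ Vec.replicate vars (con 1)
  loopBounds = bitsBound 𝕟 ∷ groupBound ∷ bitsBound M ∷ Vec.replicate vars (con 1)

  scanTime mainTime testTime copyTime evalTime : Bound
  scanTime = cost scan loopBounds
  mainTime = loopBound M groupBound scanTime ⊕ cost {⊥} (𝑋 ≔ cons (var 𝑋) (var 𝐵)) loopBounds
    ⊕ (runtime at (𝕟 ⊕ M)) ⊕ con 50
  testTime = timeBound (var 𝐵) (after dispatch startBounds)
  copyTime = cost {⊥} (𝑋 ≔ var 𝐵) (after dispatch startBounds)
  evalTime = cost dispatch startBounds ⊕ (con 1 ⊕ (testTime ⊕ (copyTime ⊕ mainTime)))

  fits-nils : ∀ n v → Fits n (Vec.replicate v nil) (Vec.replicate v (con 1))
  fits-nils n zero    = []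
  fits-nils n (suc v) = ≤-refl ∷ fits-nils n v

  module _ (x : List Bool) where

    n m : ℕ
    n = length x
    m = ⟦ witnessLength ⟧ n

    open Network (network m) using (L)
    open Model m (verdict x)

    nils : Store vars
    nils = Vec.replicate vars nil

    state : Tree → List Bool → Store k
    state a u = codeBits x ∷ a ∷ codeBits u ∷ nils

    fits : ∀ {j S u} → j ≤ m → j + length u ≤ m → Fits n (state (codeSubset {StageLinks j} S) u) loopBounds
    fits {j} {S} {u} j≤ ju≤ =
      codeBits≤ n 𝕟 x ≤-refl
        ∷ codeBits≤ n (M ⊗ con 5) (Vec.toList S) (≤-trans
            (≤-reflexive (trans (Vecₚ.length-toList S) (stageLinks≡ j))) (*-monoˡ-≤ 5 j≤))
        ∷ codeBits≤ n M u (≤-trans (m≤n+m _ j) ju≤) ∷ fits-nils n vars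

    -- The cases follow `decode`, so each pass is checked by computation. The invariant
    -- `j + length u ≤ m` keeps the growing witness within its size bound.
    scan-exec : ∀ j S u → j ≤ m → j + length u ≤ m →
      Exec noOracle (while (var 𝐴) scan) (state (codeSubset {StageLinks j} S) u)
        (j * (1 + (⟪ groupBound ⟫ n + ⟪ scanTime ⟫ n)) + (1 + ⟪ groupBound ⟫ n))
        (state nil (decode j S u))
    scan-exec zero [] u j≤ ju≤ =
      while-stop (⟪ scanTime ⟫ n) refl (s≤s z≤n)
    scan-exec (suc j) (true ∷ c ∷ d ∷ e ∷ f ∷ S) u j≤ ju≤ =
      while-step j refl (Pointwise.lookup (fits {suc j} {true ∷ c ∷ d ∷ e ∷ f ∷ S} {u} j≤ ju≤) 𝐴)
        (straight scan loopBounds (fits {suc j} {true ∷ c ∷ d ∷ e ∷ f ∷ S} {u} j≤ ju≤))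
        (scan-exec j S (true ∷ u) (≤-trans (n≤1+n j) j≤)
          (≤-trans (≤-reflexive (+-suc j (length u))) ju≤))
    scan-exec (suc j) (false ∷ true ∷ d ∷ e ∷ f ∷ S) u j≤ ju≤ =
      while-step j refl (Pointwise.lookup (fits {suc j} {false ∷ true ∷ d ∷ e ∷ f ∷ S} {u} j≤ ju≤) 𝐴)
        (straight scan loopBounds (fits {suc j} {false ∷ true ∷ d ∷ e ∷ f ∷ S} {u} j≤ ju≤))
        (scan-exec j S (false ∷ u) (≤-trans (n≤1+n j) j≤)
          (≤-trans (≤-reflexive (+-suc j (length u))) ju≤))
    scan-exec (suc j) (false ∷ false ∷ d ∷ e ∷ f ∷ S) u j≤ ju≤ =
      while-step j refl (Pointwise.lookup (fits {suc j} {false ∷ false ∷ d ∷ e ∷ f ∷ S} {u} j≤ ju≤) 𝐴)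
        (straight scan loopBounds (fits {suc j} {false ∷ false ∷ d ∷ e ∷ f ∷ S} {u} j≤ ju≤))
        (scan-exec j S u (≤-trans (n≤1+n j) j≤) (≤-trans (n≤1+n _) ju≤))

    -- No size bounds are tracked for the store the verifier leaves, so `straight` does not apply.
    -- But only the verdict is read, and 50 is ample for the two constants.
    finish-exec : ∀ a σ b → a ≡ codeBool b →
      Exec noOracle finish (a ∷ σ) 50 (codeℚ (verdictRatio b) ∷ σ)
    finish-exec _ σ true  refl = _ , ≤ᵇ⇒≤ _ 50 tt , if-true refl assign
    finish-exec _ σ false refl = _ , ≤ᵇ⇒≤ _ 50 tt , if-false refl assign

    main-exec : ∀ S → ∃[ τ ] Exec noOracle main (state (codeSubset S) []) (⟪ mainTime ⟫ n)
                               (codeℚ (verdictRatio (verdict x (decode m S []))) ∷ τ)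
    main-exec S with verifies x (decode m S [])
    ... | t , a ∷ τ , t≤ , run , eq = _ ,
      ((scan-exec m S [] ≤-refl (≤-reflexive (+-identityʳ m)))
        ⟫ straight (𝑋 ≔ cons (var 𝑋) (var 𝐵)) loopBounds
            (fits {0} {[]} {u} z≤n u≤)
        -- After the scan `𝐴` is nil and `𝐵` holds the witness; the verifier's other variables are
        -- still nil, as its run requires.
        ⟫ (t , ≤-trans t≤ (⟦⟧-mono runtime (+-monoʳ-≤ n u≤)) ,
            run-embed nil (codeBits u) run)
        ⟫ finish-exec a _ (verdict x u) eq)
      where
      u : List Bool
      u = decode m S []
      u≤ : length u ≤ m
      u≤ = ≤-trans (length-decode m S []) (≤-reflexive (+-identityʳ m))

    start : Subset L → Store k
    start S = initial (codeBits x ∙ codeSubset S)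

    start-fits : ∀ S → Fits n (start S) startBounds
    start-fits S =
      s≤s (+-mono-≤ (codeBits≤ n 𝕟 x ≤-refl) (codeBits≤ n (con 3 ⊕ M ⊗ con 5) (Vec.toList S)
        (≤-reflexive (trans (Vecₚ.length-toList S) (cong (3 +_) (stageLinks≡ m))))))
        ∷ ≤-refl ∷ ≤-refl ∷ fits-nils n vars

    -- Every rational, even 0, is encoded as a pair, so a cost in `𝐵` is recognised by `𝐵` not being
    -- nil.
    known : ∀ S {a b ρ} → exec dispatch (start S) ≡ codeBits x ∷ codeSubset S ∷ (a ∙ b) ∷ ρ →
      ∃[ τ ] Exec noOracle eval-body (start S) (⟪ evalTime ⟫ n) ((a ∙ b) ∷ τ)
    known S {a} {b} {ρ} eq = _ ,
      (straight dispatch startBounds (start-fits S)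
        ⟫ weaken (s≤s (+-monoʳ-≤ (⟪ testTime ⟫ n) (m≤m+n (⟪ copyTime ⟫ n) (⟪ mainTime ⟫ n))))
            (subst (λ σ → Exec noOracle (ifte (var 𝐵) (𝑋 ≔ var 𝐵) main) σ
                            (1 + (⟪ testTime ⟫ n + ⟪ copyTime ⟫ n))
                            ((a ∙ b) ∷ codeSubset S ∷ (a ∙ b) ∷ ρ))
              (sym eq)
              (if-true-exec refl (Pointwise.lookup dispatched 𝐵)
                (straight (𝑋 ≔ var 𝐵) (after dispatch startBounds) dispatched))))
      where
      dispatched : Fits n (codeBits x ∷ codeSubset S ∷ (a ∙ b) ∷ ρ) (after dispatch startBounds)
      dispatched = subst (λ σ → Fits n σ (after dispatch startBounds)) eq
        (exec-after dispatch {bs = startBounds} (start-fits S))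

    evaluates : ∀ S → ∃[ τ ] Exec noOracle eval-body (start S) (⟪ evalTime ⟫ n) (codeℚ (price S) ∷ τ)
    evaluates S@(true  ∷ true  ∷ _     ∷ _) = known S refl
    evaluates S@(true  ∷ false ∷ _     ∷ _) = known S refl
    evaluates S@(false ∷ false ∷ _     ∷ _) = known S refl
    evaluates S@(false ∷ true  ∷ false ∷ _) = known S refl
    evaluates (false ∷ true  ∷ true  ∷ S) = proj₁ (main-exec S) ,
      (straight dispatch startBounds (start-fits S′)
        ⟫ weaken (s≤s (+-monoʳ-≤ (⟪ testTime ⟫ n) (m≤n+m (⟪ mainTime ⟫ n) (⟪ copyTime ⟫ n))))
            (if-false-exec refl (Pointwise.lookup dispatched 𝐵) (proj₂ (main-exec S))))
      where
      S′ : Subset L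
      S′ = false ∷ true ∷ true ∷ S
      dispatched : Fits n (state (codeSubset S) []) (after dispatch startBounds)
      dispatched = exec-after dispatch {bs = startBounds} (start-fits S′)

-- Paths of the network

∈-linkSet-head : ∀ {k} (i : Fin k) is → i ∈ linkSet (i ∷ is)
∈-linkSet-head i is = x∈p∪q⁺ (inj₁ (x∈⁅x⁆ i))

∈-linkSet-tail : ∀ {k i} (j : Fin k) is → i ∈ linkSet is → i ∈ linkSet (j ∷ is)
∈-linkSet-tail j is i∈ = x∈p∪q⁺ (inj₂ i∈)

module Paths (m : ℕ) where

  open Network (network m)
  open Witness (top m)

  source : Node
  source = clamp (top m) (top m)

  toℕ-source : toℕ source ≡ top m
  toℕ-source = toℕ-clamp (≤-refl {top m})

  downward : ∀ l → toℕ (head l) < toℕ (tail l)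
  downward l = proj₁ (All.lookup (map-arc-descending ≤-refl (arcs-descending m)) (∈-lookup l))

  heads-below : ∀ {u v} ls → IsWalk u ls v → All (λ w → toℕ w < toℕ u) (map head ls)
  heads-below []       _          = []
  heads-below (l ∷ ls) (refl , w) =
    downward l ∷ All.map (λ w< → <-trans w< (downward l)) (heads-below ls w)

  walk-simple : ∀ {u v} ls → IsWalk u ls v → Unique (u ∷ map head ls)
  walk-simple []       _            = [] ∷ []
  walk-simple (l ∷ ls) w₀@(_ , w) =
    All.map (λ { w< refl → <-irrefl refl w< }) (heads-below (l ∷ ls) w₀) ∷ walk-simple ls w

  -- Each link lowers the node number. This is what limits the size of the oracle's answer.
  walk-length : ∀ {u v} ls → IsWalk u ls v → length ls ≤ toℕ u
  walk-length []       _          = z≤n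
  walk-length (l ∷ ls) (refl , w) = ≤-trans (s≤s (walk-length ls w)) (downward l)

  fromWalk : ∀ {u v} ls → Walk links u ls v → IsWalk u ls v
  fromWalk []       w       = w
  fromWalk (l ∷ ls) (e , w) = e , fromWalk ls w

  path : ∀ {u v} ls → IsWalk u ls v → Path u v
  path ls w = record { route = ls ; isWalk = w ; simple = walk-simple ls w }

  directPath : Path source zero
  directPath = path (zero ∷ []) (refl , refl)

  witnessRoute : List Bool → List Link
  witnessRoute v = suc zero ∷ suc (suc zero) ∷ shift³ (Witness.route (top m) m v)

  witnessPath : List Bool → Path source zero
  witnessPath v = path (witnessRoute v)
    (fromWalk (witnessRoute v) (refl , refl , walk-shift³ _ (route-walk m v)))

  low : ∀ l → tail (suc (suc (suc l))) ≢ clamp (top m) (2 + level m) ×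
              tail (suc (suc (suc l))) ≢ clamp (top m) (1 + level m)
  low l = (λ eq → <-irrefl (trans (cong toℕ eq) (toℕ-clamp ≤-refl)) (s≤s (m≤n⇒m≤1+n tail≤)))
        , (λ eq → <-irrefl (trans (cong toℕ eq) (toℕ-clamp (n≤1+n (1 + level m)))) (s≤s tail≤))
    where
    tail≤ : toℕ (tail (suc (suc (suc l)))) ≤ level m
    tail≤ = proj₂ (All.lookup (map-arc-descending (m≤n+m (level m) 2) (stages-descending m))
                              (∈-lookup l))

  gate≢source : clamp (top m) (1 + level m) ≢ source
  gate≢source eq = <-irrefl (trans (sym (toℕ-clamp (n≤1+n (1 + level m))))
                              (trans (cong toℕ eq) toℕ-source)) ≤-refl

  -- Only the beginning of a route is classified: prices are estimated for all sets that contain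
  -- these links, whatever follows.
  data Start : List Link → Set where
    direct : ∀ {ls} → Start (zero ∷ ls)
    gated  : ∀ {ls} → Start (suc zero ∷ suc (suc zero) ∷ ls)

  start : ∀ ls → IsWalk source ls zero → Start ls
  start []                      ()
  start (zero ∷ ls)             w = direct
  start (suc (suc zero) ∷ ls)   (eq , _) = ⊥-elim (gate≢source eq)
  start (suc (suc (suc l)) ∷ ls) (eq , _) = ⊥-elim (proj₁ (low l) eq)
  start (suc zero ∷ [])         (_ , ())
  start (suc zero ∷ zero ∷ ls)  (_ , eq , _) = ⊥-elim (gate≢source (sym eq))
  start (suc zero ∷ suc zero ∷ ls) (_ , eq , _) = ⊥-elim (gate≢source (sym eq))
  start (suc zero ∷ suc (suc zero) ∷ ls) w = gated
  start (suc zero ∷ suc (suc (suc l)) ∷ ls) (_ , eq , _) = ⊥-elim (proj₂ (low l) eq)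

-- Prices of routes and acceptance of witnesses.

module Prices (m : ℕ) (accepts : List Bool → Bool) where

  open Network (network m) using (L)
  open Model m accepts
  open Paths m

  Accepted : Set
  Accepted = ∃[ u ] length u ≤ m × accepts u ≡ true

  ½≤1 : ½ ℚ.≤ 1ℚ
  ½≤1 = from-yes (½ ℚ.≤? 1ℚ)

  1≤2 : 1ℚ ℚ.≤ 2ℚ
  1≤2 = from-yes (1ℚ ℚ.≤? 2ℚ)

  2≰1 : ¬ 2ℚ ℚ.≤ 1ℚ
  2≰1 = from-no (2ℚ ℚ.≤? 1ℚ)

  ½≤verdictRatio : ∀ b → ½ ℚ.≤ verdictRatio b
  ½≤verdictRatio true  = ℚₚ.≤-refl
  ½≤verdictRatio false = from-yes (½ ℚ.≤? 2ℚ)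

  direct-price : ∀ (S : Subset L) → zero ∈ S → 1ℚ ℚ.≤ price S
  direct-price (true ∷ true  ∷ _ ∷ _) Vec.here = 1≤2
  direct-price (true ∷ false ∷ _ ∷ _) Vec.here = ℚₚ.≤-refl

  gated-price : ∀ (S : Subset L) → suc zero ∈ S → ½ ℚ.≤ price S
  gated-price (true  ∷ true ∷ _     ∷ _) _ = from-yes (½ ℚ.≤? 2ℚ)
  gated-price (false ∷ true ∷ false ∷ _) _ = ½≤1
  gated-price (false ∷ true ∷ true  ∷ S) _ = ½≤verdictRatio (accepts (decode m S []))
  gated-price (b ∷ false ∷ _ ∷ _) (Vec.there ())

  -- Adding the direct link would raise the price to 2, and so would a rejected witness; hence the
  -- decoded witness is accepted.
  cheap⇒accepted : ∀ (S : Subset L) → suc zero ∈ S → suc (suc zero) ∈ S → price S ℚ.≤ 1ℚ → Accepted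
  cheap⇒accepted (b     ∷ false ∷ _     ∷ _) (Vec.there ()) _ _
  cheap⇒accepted (b     ∷ true  ∷ false ∷ _) _ (Vec.there (Vec.there ())) _
  cheap⇒accepted (true  ∷ true  ∷ true  ∷ _) _ _ cheap = ⊥-elim (2≰1 cheap)
  cheap⇒accepted (false ∷ true  ∷ true  ∷ S) _ _ cheap with accepts (decode m S []) in eq
  ... | true  = decode m S [] ,
                ≤-trans (length-decode m S []) (≤-reflexive (+-identityʳ m)) , eq
  ... | false = ⊥-elim (2≰1 cheap)

  routePrice : List (Fin L) → ℚ
  routePrice ls = price (linkSet ls)

  direct≤ : ∀ ls → 1ℚ ℚ.≤ routePrice (zero ∷ ls)
  direct≤ ls = direct-price (linkSet (zero ∷ ls)) (∈-linkSet-head zero ls)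

  gate∈ : ∀ (ls : List (Fin L)) → suc zero ∈ linkSet (suc zero ∷ suc (suc zero) ∷ ls)
  gate∈ ls = ∈-linkSet-head (suc zero) (suc (suc zero) ∷ ls)

  gated≤1⇒accepted : ∀ ls → routePrice (suc zero ∷ suc (suc zero) ∷ ls) ℚ.≤ 1ℚ → Accepted
  gated≤1⇒accepted ls = cheap⇒accepted (linkSet (suc zero ∷ suc (suc zero) ∷ ls)) (gate∈ ls)
    (∈-linkSet-tail (suc zero) (suc (suc zero) ∷ ls) (∈-linkSet-head (suc (suc zero)) ls))

  ½≤price : ∀ {ls} → Start ls → ½ ℚ.≤ routePrice ls
  ½≤price (direct {ls}) = ℚₚ.≤-trans ½≤1 (direct≤ ls)
  ½≤price (gated {ls})  = gated-price (linkSet (suc zero ∷ suc (suc zero) ∷ ls)) (gate∈ ls)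

  witness-price : ∀ {u} → length u ≤ m → accepts u ≡ true →
    routePrice (witnessRoute (reverse u)) ≡ ½
  witness-price {u} u≤ acc
    rewrite linkSet-shift³ (route m (reverse u))
          | ∪-identityˡ (linkSet (route m (reverse u)))
          | ∪-identityˡ (linkSet (route m (reverse u)))
          | decode-route m (reverse u) [] (≤-trans (≤-reflexive (length-reverse u)) u≤)
          | reverse-involutive u
          | acc
    = refl

  -- Exhaustive search, branching on the first bit. It replaces excluded middle in the proof that a
  -- shortest path exists.
  accepted? : ∀ m (f : List Bool → Bool) → Dec (∃[ u ] length u ≤ m × f u ≡ true)
  accepted? m f with f [] in eq
  accepted? m f | true = yes ([] , z≤n , eq)
  accepted? zero f | false = no λ { ([] , _ , acc) → not-¬ eq acc }
  accepted? (suc m) f | false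
    with accepted? m (λ u → f (true ∷ u)) | accepted? m (λ u → f (false ∷ u))
  ... | yes (u , u≤ , acc) | _ = yes (true ∷ u , s≤s u≤ , acc)
  ... | no _ | yes (u , u≤ , acc) = yes (false ∷ u , s≤s u≤ , acc)
  ... | no ¬t | no ¬f = no λ
    { ([] , _ , acc)             → not-¬ eq acc
    ; (true ∷ u , s≤s u≤ , acc)  → ¬t (u , u≤ , acc)
    ; (false ∷ u , s≤s u≤ , acc) → ¬f (u , u≤ , acc)
    }

  1≤price : ¬ Accepted → ∀ {ls} → Start ls → 1ℚ ℚ.≤ routePrice ls
  1≤price none (direct {ls}) = direct≤ ls
  1≤price none (gated {ls}) with ℚₚ.≤-total 1ℚ (routePrice (suc zero ∷ suc (suc zero) ∷ ls))
  ... | inj₁ 1≤ = 1≤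
  ... | inj₂ ≤1 = ⊥-elim (none (gated≤1⇒accepted ls ≤1))

-- The instance

module Reduction {A : Language} (np : NP A) where

  open NP np
  open Evaluator np using (evaluator; evalTime; evaluates)

  abstract
    allowancePolynomial : Polynomial
    allowancePolynomial = polynomial evalTime

    allowance-correct : ∀ n → ⟪ evalTime ⟫ n ≡ ⟦ allowancePolynomial ⟧ n
    allowance-correct = polynomial-correct evalTime

  inst : List Bool → SPDCM-Instance
  inst x = record
    { network     = network m
    ; source      = Paths.source m
    ; destination = zero
    ; model       = model
    ; description = record
      { payload   = codeBits x
      ; evaluator = evaluator
      ; allowance = ⟦ allowancePolynomial ⟧ (length x)
      }
    ; describes   = describes
    }
    where
    m : ℕ
    m = ⟦ witnessLength ⟧ (length x)
    open Model m (verdict x)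
    describes : ∀ S → Nonempty S →
      Outputs noOracle evaluator (codeBits x ∙ codeSubset S) (codeℚ (Correlated.jointCost model S))
              (⟦ allowancePolynomial ⟧ (length x))
    describes S _ with evaluates x S
    ... | τ , t , t≤ , run = t , _ , ≤-trans t≤ (≤-reflexive (allowance-correct (length x))) ,
      run , cong codeℚ (sym (jointCost≡price S))

  module _ (x : List Bool) where

    open SPDCM-Instance (inst x) using (source; Shortest) renaming (cost to pathCost)

    m : ℕ
    m = ⟦ witnessLength ⟧ (length x)

    open Network (network m) using (Path)
    open Model m (verdict x) using (jointCost≡price)
    open Paths m hiding (source)
    open Prices m (verdict x)

    cost≡ : ∀ p → pathCost p ≡ routePrice (Path.route p)
    cost≡ p = jointCost≡price (Path.linkSet p)

    start-of : (p : Path source zero) → Start (Path.route p)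
    start-of p = start (Path.route p) (Path.isWalk p)

    shortest : ∃[ p ] Shortest p
    shortest with accepted? m (verdict x)
    ... | yes (u , u≤ , acc) = witnessPath (reverse u) , λ q →
      subst₂ ℚ._≤_ (sym (trans (cost≡ (witnessPath (reverse u))) (witness-price u≤ acc)))
        (sym (cost≡ q)) (½≤price (start-of q))
    ... | no none = directPath , λ q →
      subst₂ ℚ._≤_ (sym (cost≡ directPath)) (sym (cost≡ q)) (1≤price none (start-of q))

    answerBit : ∀ {ls} → Start ls → Bool
    answerBit direct = false
    answerBit gated  = true

    answer-correct : ∀ {ls} (st : Start ls) →
      (∀ (q : Path source zero) → routePrice ls ℚ.≤ routePrice (Path.route q)) →
      A x ⇔ answerBit st ≡ true
    answer-correct (direct {ls}) short =
      mk⇔ (λ member → ⊥-elim (absurd (Equivalence.to (correct x) member))) λ ()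
      where
      absurd : ¬ Accepted
      -- An accepted witness gives a route of price 1/2, while every route with the direct link
      -- costs at least 1.
      absurd (u , u≤ , acc) = from-no (1ℚ ℚ.≤? ½)
        (ℚₚ.≤-trans (direct≤ ls) (ℚₚ.≤-trans (short (witnessPath (reverse u)))
          (ℚₚ.≤-reflexive (witness-price u≤ acc))))
    answer-correct (gated {ls}) short = mk⇔ (λ _ → refl) λ _ →
      -- The direct path costs exactly 1, by computation, so the shortest path costs at most 1.
      Equivalence.from (correct x) (gated≤1⇒accepted ls (short directPath))

-- The reduction program

level≡ : ∀ j → level j ≡ j * 3
level≡ zero    = refl
level≡ (suc j) = cong (3 +_) (level≡ j)

codeArc : ℕ × ℕ → Tree
codeArc (a , b) = unary a ∙ unary b

codeArcs : List (ℕ × ℕ) → Tree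
codeArcs = codeList codeArc

codeLinks≡ : ∀ {K xs} → All (Descending K) xs →
  codeList (λ (u , v) → codeFin u ∙ codeFin v) (map (arc K) xs) ≡ codeArcs xs
codeLinks≡ []                   = refl
codeLinks≡ ((b<a , a≤K) ∷ desc) =
  cong₂ _∙_ (cong₂ (λ a b → unary a ∙ unary b)
               (toℕ-clamp a≤K) (toℕ-clamp (≤-trans (<⇒≤ b<a) a≤K)))
            (codeLinks≡ desc)

codeListBound : Bound → Bound → Bound
codeListBound count item = con 1 ⊕ count ⊗ (con 1 ⊕ item)

codeList≤ : ∀ {A : Set} {f : A → Tree} {xs s} → All (λ x → size (f x) ≤ s) xs →
  size (codeList f xs) ≤ 1 + length xs * (1 + s)
codeList≤ []             = ≤-refl
codeList≤ {xs = x ∷ xs} {s} (x≤ ∷ xs≤) =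
  ≤-trans (s≤s (+-mono-≤ x≤ (codeList≤ xs≤))) (≤-reflexive (lemma s (length xs * (1 + s))))
  where
  lemma : ∀ s t → suc (s + (1 + t)) ≡ 1 + (1 + s + t)
  lemma = solve-∀

length-stages : ∀ j → length (stages j) ≡ j * 5
length-stages zero    = refl
length-stages (suc j) = cong (5 +_) (length-stages j)

module ReductionProgram {A : Language} (np : NP A) where

  open NP np using (witnessLength)
  open Evaluator np using (evaluator)
  open Reduction np using (inst; allowancePolynomial; start-of; answerBit)

  R : ℕ
  R = 10

  -- Positions 0 to 5 are those of `Horner`. The four behind them hold the witness bound, the
  -- allowance, the arcs built so far and the level reached.
  𝑋 𝑁 𝑅 𝐼 𝑀 𝑊 𝐾 𝐶 : Fin R
  𝑋 = # 0
  𝑁 = # 1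
  𝑅 = # 2
  𝐼 = # 4
  𝑀 = # 6
  𝑊 = # 7
  𝐾 = # 8
  𝐶 = # 9

  open Horner {⊤} {4} using (horner; hornerTime; horner-exec; clean; bounds)

  sucᵉ : Expr R → Expr R
  sucᵉ = cons nil

  -- Copies of `stage` and `entry` on codes: given codes of a level and of arcs, they evaluate by
  -- computation to the code of the extended list.
  stageᵉ entryᵉ : Expr R → Expr R → Expr R
  stageᵉ l k =
    cons (cons (sucᵉ (sucᵉ (sucᵉ l))) (sucᵉ l)) (cons (cons (sucᵉ (sucᵉ (sucᵉ l))) (sucᵉ (sucᵉ l)))
      (cons (cons (sucᵉ l) l) (cons (cons (sucᵉ (sucᵉ l)) l) (cons (cons (sucᵉ (sucᵉ (sucᵉ l))) l) k))))
  entryᵉ l k =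
    cons (cons (sucᵉ (sucᵉ l)) nil) (cons (cons (sucᵉ (sucᵉ l)) (sucᵉ l)) (cons (cons (sucᵉ l) l) k))

  assemble : Expr R
  assemble =
    cons (sucᵉ (sucᵉ (sucᵉ (var 𝐶)))) (cons (entryᵉ (var 𝐶) (var 𝐾))
      (cons (sucᵉ (sucᵉ (var 𝐶))) (cons nil
        (cons (var 𝑋) (cons (constant (codeProgram evaluator)) (var 𝑊))))))

  count build storeM storeW answer body : Cmd ⊤ R
  count  = 𝑁 ≔ cons nil (var 𝑁) ⨾ 𝐼 ≔ tl (var 𝐼)
  -- `𝐾` comes before `𝐶`, because the new stage is placed on the old level.
  build  = 𝐾 ≔ stageᵉ (var 𝐶) (var 𝐾) ⨾ 𝐶 ≔ sucᵉ (sucᵉ (sucᵉ (var 𝐶))) ⨾ 𝐼 ≔ tl (var 𝐼)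
  -- The second polynomial evaluation must again start from a nil result variable.
  storeM = 𝑀 ≔ var 𝑅 ⨾ 𝑅 ≔ nil
  storeW = 𝑊 ≔ var 𝑅 ⨾ 𝐼 ≔ var 𝑀
  -- The first link of the route decides: link 0, the direct one, has code nil, while link 1 has a
  -- code that is not nil.
  answer = ifte (hd (var 𝑋)) (𝑋 ≔ cons nil nil) (𝑋 ≔ nil)
  body =
    𝐼 ≔ var 𝑋 ⨾ while (var 𝐼) count ⨾ horner witnessLength ⨾ storeM ⨾
    horner allowancePolynomial ⨾ storeW ⨾ while (var 𝐼) build ⨾ ask tt 𝑋 assemble ⨾ answer

  reduction : Program ⊤
  reduction = program 9 body

  X M W Λ arcBound 𝐾Bound answerBound : Bound
  X           = bitsBound 𝕟
  M           = witnessLength at 𝕟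
  W           = allowancePolynomial at 𝕟
  Λ           = M ⊗ con 3
  arcBound    = con 1 ⊕ unaryBound Λ ⊕ unaryBound Λ
  𝐾Bound      = codeListBound (M ⊗ con 5) arcBound
  answerBound = codeListBound (con 2 ⊕ Λ) (unaryBound (con 3 ⊕ M ⊗ con 5))

  rest₀ rest₁ : Vec Bound 4
  rest₀ = con 1 ∷ con 1 ∷ con 1 ∷ con 1 ∷ []
  rest₁ = unaryBound M ∷ con 1 ∷ con 1 ∷ con 1 ∷ []

  startBounds countBounds storeMBounds storeWBounds buildBounds answerBounds : Vec Bound R
  startBounds  = X ∷ con 1 ∷ con 1 ∷ con 1 ∷ con 1 ∷ con 1 ∷ rest₀
  countBounds  = X ∷ unaryBound 𝕟 ∷ con 1 ∷ con 1 ∷ X ∷ con 1 ∷ rest₀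
  storeMBounds = clean X rest₀ (unaryBound M)
  storeWBounds = clean X rest₁ (unaryBound W)
  buildBounds  =
    bounds X (unaryBound M ∷ unaryBound W ∷ 𝐾Bound ∷ unaryBound Λ ∷ [])
      (unaryBound W) (con 1) (unaryBound M) (con 1)
  answerBounds = buildBounds Vec.[ 𝑋 ]≔ answerBound

  totalTime : Bound
  totalTime =
    cost {⊤} (𝐼 ≔ var 𝑋) startBounds ⊕ loopBound 𝕟 X (cost count countBounds)
      ⊕ hornerTime X rest₀ witnessLength ⊕ cost storeM storeMBounds
      ⊕ hornerTime X rest₁ allowancePolynomial ⊕ cost storeW storeWBounds
      ⊕ loopBound M (unaryBound M) (cost build buildBounds)
      ⊕ (con 1 ⊕ (timeBound assemble buildBounds ⊕ answerBound)) ⊕ cost answer answerBounds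

  abstract
    totalPolynomial : Polynomial
    totalPolynomial = polynomial totalTime

    total-correct : ∀ n → ⟪ totalTime ⟫ n ≡ ⟦ totalPolynomial ⟧ n
    total-correct = polynomial-correct totalTime

  module _ (O : Tree → Tree) (x : List Bool) where

    O′ : Oracles ⊤
    O′ _ = O

    n m w : ℕ
    n = length x
    m = ⟦ witnessLength ⟧ n
    w = ⟦ allowancePolynomial ⟧ n

    code : Tree
    code = SPDCM-Instance.codeInstance (inst x)

    x≤ : size (codeBits x) ≤ ⟪ X ⟫ n
    x≤ = codeBits≤ n 𝕟 x ≤-refl

    counting : List Bool → ℕ → Store R
    counting l a =
      codeBits x ∷ unary a ∷ nil ∷ nil ∷ codeBits l ∷ nil ∷ nil ∷ nil ∷ nil ∷ nil ∷ []

    count-exec : ∀ l a → length l + a ≡ n →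
      Exec O′ (while (var 𝐼) count) (counting l a)
        (length l * (1 + (⟪ X ⟫ n + ⟪ cost count countBounds ⟫ n)) + (1 + ⟪ X ⟫ n))
        (counting [] n)
    count-exec []      a refl = while-stop (⟪ cost count countBounds ⟫ n) refl (s≤s z≤n)
    count-exec (b ∷ l) a eq   =
      while-step (length l) refl l≤
        (straight {n} count countBounds
          (x≤ ∷ unary≤ n 𝕟 (≤-trans (m≤n+m a (length (b ∷ l))) (≤-reflexive eq)) ∷ ≤-refl ∷ ≤-refl
            ∷ l≤ ∷ ≤-refl ∷ ≤-refl ∷ ≤-refl ∷ ≤-refl ∷ ≤-refl ∷ []))
        (count-exec l (suc a) (trans (+-suc (length l) a) eq))
      where
      l≤ : size (codeBits (b ∷ l)) ≤ ⟪ X ⟫ n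
      l≤ = codeBits≤ n 𝕟 (b ∷ l) (≤-trans (m≤m+n _ a) (≤-reflexive eq))

    building : Tree → ℕ → ℕ → Store R
    building t i j =
      t ∷ unary n ∷ unary w ∷ nil ∷ unary i ∷ nil ∷ unary m ∷ unary w ∷ codeArcs (stages j)
        ∷ unary (level j) ∷ []

    level≤ : ∀ {j} → j ≤ m → level j ≤ ⟪ Λ ⟫ n
    level≤ {j} j≤ = ≤-trans (≤-reflexive (level≡ j)) (*-monoˡ-≤ 3 j≤)

    arcs≤ : ∀ j → j ≤ m → size (codeArcs (stages j)) ≤ ⟪ 𝐾Bound ⟫ n
    arcs≤ j j≤ = ≤-trans (codeList≤ {s = ⟪ arcBound ⟫ n} (All.map small (stages-descending j)))
      (s≤s (*-monoˡ-≤ (1 + ⟪ arcBound ⟫ n)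
        (≤-trans (≤-reflexive (length-stages j)) (*-monoˡ-≤ 5 j≤))))
      where
      small : ∀ {p} → Descending (level j) p → size (codeArc p) ≤ ⟪ arcBound ⟫ n
      small (b<a , a≤) = s≤s (+-mono-≤ (unary≤ n Λ (≤-trans a≤ (level≤ j≤)))
                                       (unary≤ n Λ (≤-trans (<⇒≤ b<a) (≤-trans a≤ (level≤ j≤)))))

    building-fits : ∀ {t b} i j → size t ≤ ⟪ b ⟫ n → i ≤ m → j ≤ m →
      Fits n (building t i j) (buildBounds Vec.[ 𝑋 ]≔ b)
    building-fits i j t≤ i≤ j≤ =
      t≤ ∷ unary≤ n 𝕟 ≤-refl ∷ unary≤ n W ≤-refl ∷ ≤-refl ∷ unary≤ n M i≤ ∷ ≤-refl
        ∷ unary≤ n M ≤-refl ∷ unary≤ n W ≤-refl ∷ arcs≤ j j≤ ∷ unary≤ n Λ (level≤ j≤) ∷ []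

    build-exec : ∀ i j → i + j ≡ m →
      Exec O′ (while (var 𝐼) build) (building (codeBits x) i j)
        (i * (1 + (⟪ unaryBound M ⟫ n + ⟪ cost build buildBounds ⟫ n)) + (1 + ⟪ unaryBound M ⟫ n))
        (building (codeBits x) 0 m)
    build-exec zero    j refl = while-stop (⟪ cost build buildBounds ⟫ n) refl (s≤s z≤n)
    build-exec (suc i) j eq   =
      while-step i refl (unary≤ n M i≤)
        (straight build buildBounds
          (building-fits {b = X} (suc i) j x≤ i≤ (≤-trans (m≤n+m j (suc i)) (≤-reflexive eq))))
        (build-exec i (suc j) (trans (+-suc i j) eq))
      where
      i≤ : suc i ≤ m
      i≤ = ≤-trans (m≤m+n (suc i) j) (≤-reflexive eq)

    -- Computation settles all but three parts: the clamped arcs, the clamped source and the quoted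
    -- evaluator.
    assemble-eval : eval assemble (building (codeBits x) 0 m) ≡ code
    assemble-eval = sym (cong₂ (λ s t → unary (3 + level m) ∙ s ∙ t)
      (codeLinks≡ (arcs-descending m))
      (cong₂ (λ s p → unary s ∙ nil ∙ codeBits x ∙ p ∙ unary w)
        (Paths.toℕ-source m)
        (sym (eval-constant (codeProgram evaluator) (building (codeBits x) 0 m)))))

    answer-result : ∀ {ls t} (st : Paths.Start m ls) ρ → t ≡ codeList codeFin ls →
      exec answer (t ∷ ρ) ≡ codeBool (answerBit x st) ∷ ρ
    answer-result Paths.direct ρ refl = refl
    answer-result Paths.gated  ρ refl = refl

    module _ (p : Network.Path (network m) (Paths.source m) zero)
             (asked : O code ≡ codeList codeFin (Network.Path.route p)) where

      open Network (network m) using (L; module Path)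
      open Path p using (route; isWalk)

      answer≤ : size (O code) ≤ ⟪ answerBound ⟫ n
      -- The answer is exactly the code of a route: at most `top m` links, with indices below the
      -- number of links.
      answer≤ rewrite asked =
        ≤-trans (codeList≤ (All.universal index≤ route))
          (s≤s (*-monoˡ-≤ (1 + ⟪ unaryBound (con 3 ⊕ M ⊗ con 5) ⟫ n) route≤))
        where
        index≤ : ∀ l → size (codeFin l) ≤ ⟪ unaryBound (con 3 ⊕ M ⊗ con 5) ⟫ n
        index≤ l = unary≤ n (con 3 ⊕ M ⊗ con 5)
          (≤-trans (<⇒≤ (toℕ<n l)) (≤-reflexive (cong (3 +_) (Witness.stageLinks≡ (top m) m))))
        route≤ : length route ≤ 2 + ⟪ Λ ⟫ n
        route≤ = ≤-trans (Paths.walk-length m route isWalk)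
          (≤-trans (≤-reflexive (Paths.toℕ-source m)) (s≤s (s≤s (level≤ {m} ≤-refl))))

      bit : Bool
      bit = answerBit x (start-of x p)

      answer-exec : ∃[ τ ] Exec O′ answer (building (O code) 0 m) (⟪ cost answer answerBounds ⟫ n)
                             (codeBool bit ∷ τ)
      answer-exec = _ , subst (Exec O′ answer (building (O code) 0 m) (⟪ cost answer answerBounds ⟫ n))
        (answer-result (start-of x p) _ asked)
        (straight answer answerBounds (building-fits {b = answerBound} 0 m answer≤ z≤n ≤-refl))

      body-exec : ∃[ τ ] Exec O′ body (initial (codeBits x)) (⟪ totalTime ⟫ n) (codeBool bit ∷ τ)
      body-exec = _ ,
        ( straight {n} (𝐼 ≔ var 𝑋) startBounds
            (x≤ ∷ ≤-refl ∷ ≤-refl ∷ ≤-refl ∷ ≤-refl ∷ ≤-refl ∷ ≤-refl ∷ ≤-refl ∷ ≤-refl ∷ ≤-refl ∷ [])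
        ⟫ count-exec x 0 (+-identityʳ n)
        ⟫ horner-exec X rest₀ (codeBits x) n (nil ∷ nil ∷ nil ∷ nil ∷ []) x≤
            (≤-refl ∷ ≤-refl ∷ ≤-refl ∷ ≤-refl ∷ []) witnessLength
        ⟫ straight storeM storeMBounds
            (x≤ ∷ unary≤ n 𝕟 ≤-refl ∷ unary≤ n M ≤-refl ∷ ≤-refl ∷ ≤-refl ∷ ≤-refl
               ∷ ≤-refl ∷ ≤-refl ∷ ≤-refl ∷ ≤-refl ∷ [])
        ⟫ horner-exec X rest₁ (codeBits x) n (unary m ∷ nil ∷ nil ∷ nil ∷ []) x≤
            (unary≤ n M ≤-refl ∷ ≤-refl ∷ ≤-refl ∷ ≤-refl ∷ []) allowancePolynomial
        ⟫ straight storeW storeWBounds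
            (x≤ ∷ unary≤ n 𝕟 ≤-refl ∷ unary≤ n W ≤-refl ∷ ≤-refl ∷ ≤-refl ∷ ≤-refl
               ∷ unary≤ n M ≤-refl ∷ ≤-refl ∷ ≤-refl ∷ ≤-refl ∷ [])
        ⟫ build-exec m 0 (+-identityʳ m)
        ⟫ ask-exec assemble-eval
            (time≤ assemble (building-fits {b = X} 0 m x≤ z≤n ≤-refl)) answer≤
        ⟫ proj₂ answer-exec )

      outputs : Outputs O′ reduction (codeBits x) (codeBool bit) (⟦ totalPolynomial ⟧ n)
      outputs = let τ , t , t≤ , run = body-exec in
        t , (codeBool bit ∷ τ) , ≤-trans t≤ (≤-reflexive (total-correct n)) , run , refl

theorem1 : NPHard SPDCM
theorem1 A np = record
  { reduction = reduction
  ; runtime   = totalPolynomial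
  ; decides   = λ O solves x → decide O x (solves (inst x) (answer-exists x))
  }
  where
  open Reduction np
  open ReductionProgram np using (reduction; totalPolynomial; outputs; bit)
  answer-exists : ∀ x → ∃[ y ] SearchProblem.Answer SPDCM (inst x) y
  answer-exists x = _ , proj₁ (shortest x) , proj₂ (shortest x) , refl
  decide : ∀ O x → SearchProblem.Answer SPDCM (inst x) (O (SearchProblem.code SPDCM (inst x))) →
    ∃[ b ] Outputs (λ _ → O) reduction (codeBits x) (codeBool b) (⟦ totalPolynomial ⟧ (length x))
           × (A x ⇔ b ≡ true)
  decide O x (p , short , asked) = bit O x p asked , outputs O x p asked ,
    answer-correct x (start-of x p) (λ q → subst₂ ℚ._≤_ (cost≡ x p) (cost≡ x q) (short q))
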